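{- Let $\mathsf{Ctx}$ be the category of contexts for a functional language $\mathbb{F}$, and let $\mathbf{P}_0$ be a quantifier-free fragment of a first-order Boolean doctrine $\mathbf{P}\colon\mathsf{Ctx}^{\mathrm{op}}\to\mathsf{BA}$. Then there are a relational language $\mathbb{P}$ (a set of predicate symbols with arities), a theory $\mathcal{T}$ in the first-order language $(\mathbb{F},\mathbb{P})$, and a first-order Boolean doctrine isomorphism between $\mathbf{P}$ and $\mathsf{LT}^{\mathcal{T}}$ under which $\mathbf{P}_0$ corresponds to $\mathsf{LT}^{\mathcal{T}}_0$, the subfunctor of $\mathsf{LT}^{\mathcal{T}}$ of quantifier-free formulas modulo $\mathcal{T}$.
   Context: $\mathsf{BA}$ is the category of Boolean algebras and Boolean homomorphisms. A Boolean doctrine over a category $\mathsf{C}$ with finite products is a functor $\mathbf{P}\colon\mathsf{C}^{\mathrm{op}}\to\mathsf{BA}$; it is a first-order Boolean doctrine if (i) for all $X,Y\in\mathsf{C}$ the map $\mathbf{P}(\mathrm{pr}_1)\colon\mathbf{P}(X)\to\mathbf{P}(X\times Y)$ has a right adjoint $(\forall Y)_X$ (as an order-preserving map); and (ii) for every $f\colon X'\to X$ and every $Y$, $\mathbf{P}(f)\circ(\forall Y)_X=(\forall Y)_{X'}\circ\mathbf{P}(f\times\mathrm{id}_Y)$. A first-order Boolean doctrine morphism from $\mathbf{P}\colon\mathsf{C}^{\mathrm{op}}\to\mathsf{BA}$ to $\mathbf{R}\colon\mathsf{D}^{\mathrm{op}}\to\mathsf{BA}$ is a pair $(M,\mathfrak{m})$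 with $M\colon\mathsf{C}\to\mathsf{D}$ a finite-product-preserving functor and $\mathfrak{m}\colon\mathbf{P}\to\mathbf{R}\circ M^{\mathrm{op}}$ a natural transformation such that $\mathfrak{m}_X\circ(\forall Y)_X=(\forall M(Y))_{M(X)}\circ\mathfrak{m}_{X\times Y}$ for all $X,Y$. A quantifier-free fragment of a first-order Boolean doctrine $\mathbf{P}\colon\mathsf{C}^{\mathrm{op}}\to\mathsf{BA}$ is a subfunctor $\mathbf{P}_0$ of $\mathbf{P}$ (each $\mathbf{P}_0(X)$ a Boolean subalgebra of $\mathbf{P}(X)$, closed under reindexing) such that, for each $X$, $\mathbf{P}(X)=\bigcup_{n\in\mathbb{N}}\mathbf{P}_n(X)$, where, inductively, $\mathbf{P}_{n+1}(X)$ is the Boolean subalgebra of $\mathbf{P}(X)$ generated by the union, over all objects $Y$, of the images of $\mathbf{P}_n(X\times Y)$ under $(\forall Y)_X$. Syntax. A first-order language $(\mathbb{F},\mathbb{P})$ (without equality) has function symbols $\mathbb{F}$ and predicate symbols $\mathbb{P}$. Formulas are considered up to renaming of bound variables. A context is a finite list of distinct variables; $\alpha:\vec x$ means that the free variables of $\alpha$ are among $\vec x$. A theory is a set of closed formulas. $\mathsf{Ctx}$, the category of contexts for $\mathbb{F}$, has contexts as objects; a morphism $(x_1,\dots,x_n)\to(y_1,\dots,y_m)$ is an $m$-tuple of $\mathbb{F}$-terms with variables among $\vec x$; composition is simultaneous substitution. It has finite products (concatenation of contexts after renaming; the terminal object is the empty list $()$). Provability: sequents $\Gamma\Rightarrow_{\vec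 y}\Delta$ carry a context $\vec y$, with $\Gamma,\Delta$ finite lists of formulas in context $\vec y$. The rules are those of the classical sequent calculus (identity, weakening, contraction, exchange, cut, left/right rules for $\top,\bot,\land,\lor,\lnot,\to$), all within one fixed context, together with: context enlargement (from $\Gamma\Rightarrow_{\vec y}\Delta$ infer $\Gamma\Rightarrow_{(\vec y,x)}\Delta$, $x\notin\vec y$); (L$\forall$) from $\zeta[t/x],\Gamma\Rightarrow_{\vec y}\Delta$ infer $\forall x\,\zeta,\Gamma\Rightarrow_{\vec y}\Delta$, where $t$ is a term with variables in $\vec y$; (R$\forall$) from $\Gamma\Rightarrow_{(\vec y,x)}\Delta,\zeta$ infer $\Gamma\Rightarrow_{\vec y}\Delta,\forall x\,\zeta$, where $\Gamma,\Delta$ are in context $\vec y$ and $x\notin\vec y$; and the dual rules (L$\exists$), (R$\exists$). (So the empty structure is admitted as a model.) A sequent is provable from $\mathcal{T}$ if it is derivable with additional axioms $\Rightarrow_{()}\varphi$ for $\varphi\in\mathcal{T}$. The syntactic doctrine $\mathsf{LT}^{\mathcal{T}}\colon\mathsf{Ctx}^{\mathrm{op}}\to\mathsf{BA}$: $\mathsf{LT}^{\mathcal{T}}(\vec x)$ is the poset reflection of the set of formulas in context $\vec x$ preordered by: $\alpha$ below $\beta$ iff $\alpha\Rightarrow_{\vec x}\beta$ is provable from $\mathcal{T}$; reindexing is substitution. It is a first-order Boolean doctrine with $(\forall\vec y)_{\vec x}=\forall y_1\cdots\forall y_m$. $\mathsf{LT}^{\mathcal{T}}_0(\vec x)\subseteq\mathsf{LT}^{\mathcal{T}}(\vec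 x)$ is the set of equivalence classes of quantifier-free formulas in context $\vec x$. -}

module Defs where

open import Data.Fin.Base using (Fin; zero; suc; _↑ˡ_)
open import Data.Fin.Substitution using (Sub; Subs; Simple; Application)
open import Data.Fin.Substitution.Lemmas using (Lemmas₀; Lemmas₁; Lemmas₂; Lemmas₃; Lemmas₄; AppLemmas)
open import Data.List.Base as List using (List; []; _∷_; [_])
import Data.List.Properties as List
open import Data.List.Relation.Binary.Permutation.Propositional using (_↭_; ↭-refl; ↭-swap)
open import Data.List.Relation.Binary.Permutation.Propositional.Properties using (map⁺)
open import Data.Nat.Base using (ℕ; zero; suc; _+_)
open import Data.Product.Base using (Σ-syntax; _×_; _,_; proj₁; proj₂)
open import Data.Vec.Base as Vec using (Vec; []; _∷_; lookup; tabulate; _++_)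
import Data.Vec.Properties as Vec
open import Level using (Level; _⊔_; 0ℓ) renaming (suc to lsuc)
open import Relation.Binary.Construct.Closure.ReflexiveTransitive using (ε; _◅_)
open import Relation.Binary.Core using (Rel)
open import Relation.Binary.Definitions using (Adjoint)
open import Relation.Binary.Lattice.Bundles using (BooleanAlgebra)
open import Relation.Binary.PropositionalEquality as ≡
  using (_≡_; refl; sym; trans; cong; cong₂; subst; subst₂)
open import Relation.Binary.Structures using (IsEquivalence; IsPartialOrder)
open import Relation.Unary using (Pred; _∈_)

private
  variable
    o o′ m m′ e e′ c c′ ℓ₁ ℓ₁′ ℓ₂ ℓ₂′ p f r t : Level

------------------------------------------------------------------------
-- Categories with chosen finite products

record CartesianCategory (o m e : Level) : Set (lsuc (o ⊔ m ⊔ e)) where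
  infix  4 _≈_
  infixr 9 _∘ₘ_
  infixr 7 _×ₒ_
  field
    Obj           : Set o
    Hom           : Obj → Obj → Set m
    _≈_           : ∀ {X Y} → Rel (Hom X Y) e
    id            : ∀ {X} → Hom X X
    _∘ₘ_          : ∀ {X Y Z} → Hom Y Z → Hom X Y → Hom X Z
    isEquivalence : ∀ {X Y} → IsEquivalence (_≈_ {X} {Y})
    ∘-cong        : ∀ {X Y Z} {g g′ : Hom Y Z} {h h′ : Hom X Y} →
                    g ≈ g′ → h ≈ h′ → g ∘ₘ h ≈ g′ ∘ₘ h′
    ∘-assoc       : ∀ {W X Y Z} (g : Hom Y Z) (h : Hom X Y) (k : Hom W X) →
                    (g ∘ₘ h) ∘ₘ k ≈ g ∘ₘ (h ∘ₘ k)
    ∘-identityˡ   : ∀ {X Y} (g : Hom X Y) → id ∘ₘ g ≈ g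
    ∘-identityʳ   : ∀ {X Y} (g : Hom X Y) → g ∘ₘ id ≈ g

    𝟙             : Obj
    !             : ∀ {X} → Hom X 𝟙
    !-unique      : ∀ {X} (g : Hom X 𝟙) → ! ≈ g

    _×ₒ_          : Obj → Obj → Obj
    pr₁           : ∀ {X Y} → Hom (X ×ₒ Y) X
    pr₂           : ∀ {X Y} → Hom (X ×ₒ Y) Y
    ⟨_,_⟩         : ∀ {X Y Z} → Hom Z X → Hom Z Y → Hom Z (X ×ₒ Y)
    pr₁-⟨⟩        : ∀ {X Y Z} (g : Hom Z X) (h : Hom Z Y) → pr₁ ∘ₘ ⟨ g , h ⟩ ≈ g
    pr₂-⟨⟩        : ∀ {X Y Z} (g : Hom Z X) (h : Hom Z Y) → pr₂ ∘ₘ ⟨ g , h ⟩ ≈ h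
    ⟨⟩-unique     : ∀ {X Y Z} {g : Hom Z X} {h : Hom Z Y} (k : Hom Z (X ×ₒ Y)) →
                    pr₁ ∘ₘ k ≈ g → pr₂ ∘ₘ k ≈ h → ⟨ g , h ⟩ ≈ k

  _×id_ : ∀ {X′ X} → Hom X′ X → ∀ Y → Hom (X′ ×ₒ Y) (X ×ₒ Y)
  g ×id Y = ⟨ g ∘ₘ pr₁ , pr₂ ⟩

  record IsIso {X Y} (g : Hom X Y) : Set (m ⊔ e) where
    field
      inverse  : Hom Y X
      inverseˡ : inverse ∘ₘ g ≈ id
      inverseʳ : g ∘ₘ inverse ≈ id

record FiniteProductFunctor (C : CartesianCategory o m e) (D : CartesianCategory o′ m′ e′)
                            : Set (o ⊔ m ⊔ e ⊔ o′ ⊔ m′ ⊔ e′) where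
  private
    module C = CartesianCategory C
    module D = CartesianCategory D
  field
    F₀          : C.Obj → D.Obj
    F₁          : ∀ {X Y} → C.Hom X Y → D.Hom (F₀ X) (F₀ Y)
    F-cong      : ∀ {X Y} {g h : C.Hom X Y} → g C.≈ h → F₁ g D.≈ F₁ h
    F-id        : ∀ {X} → F₁ (C.id {X}) D.≈ D.id
    F-∘         : ∀ {X Y Z} (g : C.Hom Y Z) (h : C.Hom X Y) →
                  F₁ (g C.∘ₘ h) D.≈ F₁ g D.∘ₘ F₁ h
    𝟙-preserved : D.IsIso (D.! {F₀ C.𝟙})
    ×-preserved : ∀ X Y → D.IsIso D.⟨ F₁ (C.pr₁ {X} {Y}) , F₁ (C.pr₂ {X} {Y}) ⟩

  ×-iso⁻¹ : ∀ X Y → D.Hom (F₀ X D.×ₒ F₀ Y) (F₀ (X C.×ₒ Y))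
  ×-iso⁻¹ X Y = D.IsIso.inverse (×-preserved X Y)

------------------------------------------------------------------------
-- Boolean algebras

record IsBooleanHomomorphism (A : BooleanAlgebra c ℓ₁ ℓ₂) (B : BooleanAlgebra c′ ℓ₁′ ℓ₂′)
                             (h : BooleanAlgebra.Carrier A → BooleanAlgebra.Carrier B)
                             : Set (c ⊔ ℓ₁ ⊔ ℓ₁′) where
  private
    module A = BooleanAlgebra A
    module B = BooleanAlgebra B
  field
    cong-≈ : ∀ {x y} → x A.≈ y → h x B.≈ h y
    ⊤-homo : h A.⊤ B.≈ B.⊤
    ⊥-homo : h A.⊥ B.≈ B.⊥
    ∧-homo : ∀ x y → h (x A.∧ y) B.≈ h x B.∧ h y
    ∨-homo : ∀ x y → h (x A.∨ y) B.≈ h x B.∨ h y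
    ¬-homo : ∀ x → h (A.¬ x) B.≈ B.¬ (h x)

module _ (A : BooleanAlgebra c ℓ₁ ℓ₂) where
  open BooleanAlgebra A

  record IsSubalgebra (S : Pred Carrier p) : Set (c ⊔ ℓ₁ ⊔ p) where
    field
      respects-≈ : ∀ {x y} → x ≈ y → x ∈ S → y ∈ S
      ⊤-closed   : ⊤ ∈ S
      ⊥-closed   : ⊥ ∈ S
      ∧-closed   : ∀ {x y} → x ∈ S → y ∈ S → x ∧ y ∈ S
      ∨-closed   : ∀ {x y} → x ∈ S → y ∈ S → x ∨ y ∈ S
      ¬-closed   : ∀ {x} → x ∈ S → ¬ x ∈ S

  data Generated (S : Pred Carrier p) : Pred Carrier (c ⊔ ℓ₁ ⊔ p) where
    generator  : ∀ {x} → x ∈ S → x ∈ Generated S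
    respects-≈ : ∀ {x y} → x ≈ y → x ∈ Generated S → y ∈ Generated S
    ⊤-closed   : ⊤ ∈ Generated S
    ⊥-closed   : ⊥ ∈ Generated S
    ∧-closed   : ∀ {x y} → x ∈ Generated S → y ∈ Generated S → x ∧ y ∈ Generated S
    ∨-closed   : ∀ {x y} → x ∈ Generated S → y ∈ Generated S → x ∨ y ∈ Generated S
    ¬-closed   : ∀ {x} → x ∈ Generated S → ¬ x ∈ Generated S

------------------------------------------------------------------------
-- First-order Boolean doctrines

record BooleanDoctrine (C : CartesianCategory o m e) (c ℓ₁ ℓ₂ : Level)
                       : Set (o ⊔ m ⊔ e ⊔ lsuc (c ⊔ ℓ₁ ⊔ ℓ₂)) where
  open CartesianCategory C
  field
    fibre : Obj → BooleanAlgebra c ℓ₁ ℓ₂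

  module Fibre X = BooleanAlgebra (fibre X)

  field
    reindex       : ∀ {X Y} → Hom X Y → Fibre.Carrier Y → Fibre.Carrier X
    reindex-homo  : ∀ {X Y} (g : Hom X Y) →
                    IsBooleanHomomorphism (fibre Y) (fibre X) (reindex g)
    reindex-cong  : ∀ {X Y} {g h : Hom X Y} → g ≈ h →
                    ∀ α → Fibre._≈_ X (reindex g α) (reindex h α)
    reindex-id    : ∀ {X} (α : Fibre.Carrier X) → Fibre._≈_ X (reindex id α) α
    reindex-∘     : ∀ {X Y Z} (g : Hom Y Z) (h : Hom X Y) (α : Fibre.Carrier Z) →
                    Fibre._≈_ X (reindex (g ∘ₘ h) α) (reindex h (reindex g α))

record FirstOrderBooleanDoctrine (C : CartesianCategory o m e) (c ℓ₁ ℓ₂ : Level)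
                                 : Set (o ⊔ m ⊔ e ⊔ lsuc (c ⊔ ℓ₁ ⊔ ℓ₂)) where
  open CartesianCategory C
  field
    booleanDoctrine : BooleanDoctrine C c ℓ₁ ℓ₂

  open BooleanDoctrine booleanDoctrine public

  -- all X Y is (∀ Y)_X; right adjoints being unique, carrying it as data
  -- adds nothing to the mere existence of the adjoint.
  field
    all            : ∀ X Y → Fibre.Carrier (X ×ₒ Y) → Fibre.Carrier X
    all-mono       : ∀ X Y {α β} → Fibre._≤_ (X ×ₒ Y) α β →
                     Fibre._≤_ X (all X Y α) (all X Y β)
    all-adjoint    : ∀ X Y → Adjoint (Fibre._≤_ X) (Fibre._≤_ (X ×ₒ Y))
                                     (reindex pr₁) (all X Y)
    beck-chevalley : ∀ {X′ X} (g : Hom X′ X) Y (β : Fibre.Carrier (X ×ₒ Y)) →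
                     Fibre._≈_ X′ (reindex g (all X Y β)) (all X′ Y (reindex (g ×id Y) β))

record FODoctrineMorphism {C : CartesianCategory o m e} {D : CartesianCategory o′ m′ e′}
                          (P : FirstOrderBooleanDoctrine C c ℓ₁ ℓ₂)
                          (R : FirstOrderBooleanDoctrine D c′ ℓ₁′ ℓ₂′)
                          : Set (o ⊔ m ⊔ e ⊔ o′ ⊔ m′ ⊔ e′ ⊔ c ⊔ ℓ₁ ⊔ c′ ⊔ ℓ₁′) where
  private
    module C = CartesianCategory C
    module P = FirstOrderBooleanDoctrine P
    module R = FirstOrderBooleanDoctrine R
  field
    functor : FiniteProductFunctor C D

  open FiniteProductFunctor functor public

  field
    component      : ∀ X → P.Fibre.Carrier X → R.Fibre.Carrier (F₀ X)
    component-homo : ∀ X → IsBooleanHomomorphism (P.fibre X) (R.fibre (F₀ X)) (component X)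
    natural        : ∀ {X Y} (g : C.Hom X Y) (α : P.Fibre.Carrier Y) →
                     R.Fibre._≈_ (F₀ X) (component X (P.reindex g α))
                                        (R.reindex (F₁ g) (component Y α))
    -- The fibres over M (X × Y) and M X × M Y are identified along the
    -- canonical isomorphism between these objects.
    all-preserved  : ∀ X Y (α : P.Fibre.Carrier (X C.×ₒ Y)) →
                     R.Fibre._≈_ (F₀ X) (component X (P.all X Y α))
                       (R.all (F₀ X) (F₀ Y)
                         (R.reindex (×-iso⁻¹ X Y) (component (X C.×ₒ Y) α)))

-- CompositeIsIdentity G F states that G ∘ F is the identity morphism: as a
-- functor, strictly on objects, and on the fibres.
record CompositeIsIdentity {C : CartesianCategory o m e} {D : CartesianCategory o′ m′ e′}
                           {P : FirstOrderBooleanDoctrine C c ℓ₁ ℓ₂}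
                           {R : FirstOrderBooleanDoctrine D c′ ℓ₁′ ℓ₂′}
                           (G : FODoctrineMorphism R P) (F : FODoctrineMorphism P R)
                           : Set (o ⊔ m ⊔ e ⊔ c ⊔ ℓ₁) where
  private
    module C = CartesianCategory C
    module P = FirstOrderBooleanDoctrine P
    module F = FODoctrineMorphism F
    module G = FODoctrineMorphism G
  field
    on-objects   : ∀ X → G.F₀ (F.F₀ X) ≡ X
    on-morphisms : ∀ {X Y} (g : C.Hom X Y) →
                   subst₂ C.Hom (on-objects X) (on-objects Y) (G.F₁ (F.F₁ g)) C.≈ g
    on-fibres    : ∀ X (α : P.Fibre.Carrier X) →
                   P.Fibre._≈_ X (subst P.Fibre.Carrier (on-objects X)
                                   (G.component (F.F₀ X) (F.component X α)))
                                 α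

record FODoctrineIsomorphism {C : CartesianCategory o m e} {D : CartesianCategory o′ m′ e′}
                             (P : FirstOrderBooleanDoctrine C c ℓ₁ ℓ₂)
                             (R : FirstOrderBooleanDoctrine D c′ ℓ₁′ ℓ₂′)
                             : Set (o ⊔ m ⊔ e ⊔ o′ ⊔ m′ ⊔ e′ ⊔ c ⊔ ℓ₁ ⊔ c′ ⊔ ℓ₁′) where
  field
    to      : FODoctrineMorphism P R
    from    : FODoctrineMorphism R P
    from∘to : CompositeIsIdentity from to
    to∘from : CompositeIsIdentity to from

------------------------------------------------------------------------
-- Quantifier-free fragments

module _ {C : CartesianCategory o m e} (P : FirstOrderBooleanDoctrine C c ℓ₁ ℓ₂) where
  open CartesianCategory C using (Obj; Hom; _×ₒ_)
  open FirstOrderBooleanDoctrine P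

  Stage : (∀ X → Pred (Fibre.Carrier X) p) →
          ℕ → ∀ X → Pred (Fibre.Carrier X) (o ⊔ c ⊔ ℓ₁ ⊔ p)
  Stage {p = p} P₀ zero    X α = Level.Lift (o ⊔ c ⊔ ℓ₁ ⊔ p) (α ∈ P₀ X)
  Stage         P₀ (suc n) X = Generated (fibre X) λ α →
    Σ[ Y ∈ Obj ] Σ[ β ∈ Fibre.Carrier (X ×ₒ Y) ]
      (β ∈ Stage P₀ n (X ×ₒ Y) × Fibre._≈_ X (all X Y β) α)

  record QuantifierFreeFragment (p : Level) : Set (o ⊔ m ⊔ c ⊔ ℓ₁ ⊔ lsuc p) where
    field
      P₀             : ∀ X → Pred (Fibre.Carrier X) p
      isSubalgebra   : ∀ X → IsSubalgebra (fibre X) (P₀ X)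
      reindex-closed : ∀ {X Y} (g : Hom X Y) {α} → α ∈ P₀ Y → reindex g α ∈ P₀ X
      exhaustive     : ∀ X (α : Fibre.Carrier X) → Σ[ n ∈ ℕ ] α ∈ Stage P₀ n X

------------------------------------------------------------------------
-- Terms and the category of contexts

record Signature (f : Level) : Set (lsuc f) where
  field
    Symbol : Set f
    arity  : Symbol → ℕ

module _ (𝔽 : Signature f) where
  open Signature 𝔽

  -- A context of distinct variables is represented by its length n, and its
  -- variables, whose names play no role, by de Bruijn indices in Fin n; index
  -- zero is the last variable of the context.
  data Term (n : ℕ) : Set f where
    var : Fin n → Term n
    fun : (g : Symbol) → Vec (Term n) (arity g) → Term n

module TermSubstitution (𝔽 : Signature f) where
  open Signature 𝔽

  mutual
    weakenᵗ : ∀ {n} → Term 𝔽 n → Term 𝔽 (suc n)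
    weakenᵗ (var x)    = var (suc x)
    weakenᵗ (fun g ts) = fun g (weakenᵗˢ ts)

    weakenᵗˢ : ∀ {n k} → Vec (Term 𝔽 n) k → Vec (Term 𝔽 (suc n)) k
    weakenᵗˢ []       = []
    weakenᵗˢ (t ∷ ts) = weakenᵗ t ∷ weakenᵗˢ ts

  mutual
    applyᵗ : ∀ {k n} → Term 𝔽 k → Sub (Term 𝔽) k n → Term 𝔽 n
    applyᵗ (var x)    ρ = lookup ρ x
    applyᵗ (fun g ts) ρ = fun g (applyᵗˢ ts ρ)

    applyᵗˢ : ∀ {k n j} → Vec (Term 𝔽 k) j → Sub (Term 𝔽) k n → Vec (Term 𝔽 n) j
    applyᵗˢ []       ρ = []
    applyᵗˢ (t ∷ ts) ρ = applyᵗ t ρ ∷ applyᵗˢ ts ρ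

  simple : Simple (Term 𝔽)
  simple = record { var = var ; weaken = weakenᵗ }

  application : Application (Term 𝔽) (Term 𝔽)
  application = record { _/_ = applyᵗ }

  applyᵗˢ-map : ∀ {k n j} (ts : Vec (Term 𝔽 k) j) (ρ : Sub (Term 𝔽) k n) →
                applyᵗˢ ts ρ ≡ Vec.map (λ t → applyᵗ t ρ) ts
  applyᵗˢ-map []       ρ = refl
  applyᵗˢ-map (t ∷ ts) ρ = cong (_ ∷_) (applyᵗˢ-map ts ρ)

  module _ where
    open Simple simple using (_↑✶_)
    open Application application using (_/✶_)

    fun-/✶ : ∀ {k n} g ts (ρs : Subs (Term 𝔽) k n) →
             fun g ts /✶ ρs ≡ fun g (Vec.map (_/✶ ρs) ts)
    fun-/✶ g ts ε        = cong (fun g) (sym (Vec.map-id ts))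
    fun-/✶ g ts (ρ ◅ ρs) = trans (cong (λ t → applyᵗ t ρ) (fun-/✶ g ts ρs))
      (cong (fun g) (trans (applyᵗˢ-map (Vec.map (_/✶ ρs) ts) ρ) (sym (Vec.map-∘ _ _ ts))))

    mutual
      /✶-↑✶ : ∀ {k n} (ρs₁ ρs₂ : Subs (Term 𝔽) k n) →
              (∀ j x → var x /✶ ρs₁ ↑✶ j ≡ var x /✶ ρs₂ ↑✶ j) →
              ∀ j t → t /✶ ρs₁ ↑✶ j ≡ t /✶ ρs₂ ↑✶ j
      /✶-↑✶ ρs₁ ρs₂ hyp j (var x)    = hyp j x
      /✶-↑✶ ρs₁ ρs₂ hyp j (fun g ts) = trans (fun-/✶ g ts (ρs₁ ↑✶ j))
        (trans (cong (fun g) (/✶-↑✶ˢ ρs₁ ρs₂ hyp j ts)) (sym (fun-/✶ g ts (ρs₂ ↑✶ j))))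

      /✶-↑✶ˢ : ∀ {k n i} (ρs₁ ρs₂ : Subs (Term 𝔽) k n) →
               (∀ j x → var x /✶ ρs₁ ↑✶ j ≡ var x /✶ ρs₂ ↑✶ j) →
               ∀ j (ts : Vec (Term 𝔽 (j + k)) i) →
               Vec.map (_/✶ ρs₁ ↑✶ j) ts ≡ Vec.map (_/✶ ρs₂ ↑✶ j) ts
      /✶-↑✶ˢ ρs₁ ρs₂ hyp j []       = refl
      /✶-↑✶ˢ ρs₁ ρs₂ hyp j (t ∷ ts) =
        cong₂ _∷_ (/✶-↑✶ ρs₁ ρs₂ hyp j t) (/✶-↑✶ˢ ρs₁ ρs₂ hyp j ts)

  lemmas₃ : Lemmas₃ (Term 𝔽)
  lemmas₃ = record
    { lemmas₂ = record
      { lemmas₁ = record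
        { lemmas₀    = record { simple = simple }
        ; weaken-var = refl
        }
      ; application = application
      ; var-/       = refl
      }
    ; /✶-↑✶ = /✶-↑✶
    }

  mutual
    apply-wk : ∀ {n} (t : Term 𝔽 n) → applyᵗ t (Lemmas₃.wk lemmas₃) ≡ weakenᵗ t
    apply-wk (var x)    = Lemmas₃.lookup-wk lemmas₃ x
    apply-wk (fun g ts) = cong (fun g) (applyˢ-wk ts)

    applyˢ-wk : ∀ {n k} (ts : Vec (Term 𝔽 n) k) →
                applyᵗˢ ts (Lemmas₃.wk lemmas₃) ≡ weakenᵗˢ ts
    applyˢ-wk []       = refl
    applyˢ-wk (t ∷ ts) = cong₂ _∷_ (apply-wk t) (applyˢ-wk ts)

  lemmas₄ : Lemmas₄ (Term 𝔽)
  lemmas₄ = record { lemmas₃ = lemmas₃ ; /-wk = λ {_} {t} → apply-wk t }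

  mutual
    weaken-/ : ∀ {n k} (t : Term 𝔽 n) u (ρ : Sub (Term 𝔽) n k) →
               applyᵗ (weakenᵗ t) (u ∷ ρ) ≡ applyᵗ t ρ
    weaken-/ (var x)    u ρ = refl
    weaken-/ (fun g ts) u ρ = cong (fun g) (weakenˢ-/ ts u ρ)

    weakenˢ-/ : ∀ {n k j} (ts : Vec (Term 𝔽 n) j) u (ρ : Sub (Term 𝔽) n k) →
                applyᵗˢ (weakenᵗˢ ts) (u ∷ ρ) ≡ applyᵗˢ ts ρ
    weakenˢ-/ []       u ρ = refl
    weakenˢ-/ (t ∷ ts) u ρ = cong₂ _∷_ (weaken-/ t u ρ) (weakenˢ-/ ts u ρ)

  open Lemmas₄ lemmas₄ public
    using (id; _⊙_; wk; wk⋆; sub; _↑; _↑⋆_; _/_; weaken; map-weaken; ⊙-assoc;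
           id-⊙; ⊙-id; id-vanishes; /-⊙; ↑⋆-distrib; id-↑⋆)

  map-weaken-⊙-∷ : ∀ {n k j} (ρ₁ : Sub (Term 𝔽) j n) u (ρ₂ : Sub (Term 𝔽) n k) →
                   Vec.map weaken ρ₁ ⊙ (u ∷ ρ₂) ≡ ρ₁ ⊙ ρ₂
  map-weaken-⊙-∷ ρ₁ u ρ₂ =
    trans (sym (Vec.map-∘ _ _ ρ₁)) (Vec.map-cong (λ t → weaken-/ t u ρ₂) ρ₁)

  wk⋆-⊙-++ : ∀ {k n l} (ρ₁ : Sub (Term 𝔽) k l) (ρ₂ : Sub (Term 𝔽) n l) →
             wk⋆ k ⊙ (ρ₁ ++ ρ₂) ≡ ρ₂
  wk⋆-⊙-++ []       ρ₂ = id-⊙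
  wk⋆-⊙-++ (u ∷ ρ₁) ρ₂ = trans (map-weaken-⊙-∷ (wk⋆ _) u (ρ₁ ++ ρ₂)) (wk⋆-⊙-++ ρ₁ ρ₂)

  init⋆ : ∀ k n → Sub (Term 𝔽) k (k + n)
  init⋆ k n = tabulate λ i → var (i ↑ˡ n)

  init⋆-⊙-++ : ∀ {k n l} (ρ₁ : Sub (Term 𝔽) k l) (ρ₂ : Sub (Term 𝔽) n l) →
               init⋆ k n ⊙ (ρ₁ ++ ρ₂) ≡ ρ₁
  init⋆-⊙-++ {n = n} ρ₁ ρ₂ =
    trans (sym (Vec.tabulate-∘ (_/ (ρ₁ ++ ρ₂)) (λ i → var (i ↑ˡ n))))
      (trans (Vec.tabulate-cong (Vec.lookup-++ˡ ρ₁ ρ₂)) (Vec.tabulate∘lookup ρ₁))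

  ++-unique : ∀ {k n l} {ρ₁ : Sub (Term 𝔽) k l} {ρ₂ : Sub (Term 𝔽) n l}
              (ρ : Sub (Term 𝔽) (k + n) l) →
              wk⋆ k ⊙ ρ ≡ ρ₂ → init⋆ k n ⊙ ρ ≡ ρ₁ → ρ₁ ++ ρ₂ ≡ ρ
  ++-unique {k = k} ρ refl refl with Vec.splitAt k ρ
  ... | xs , ys , refl = cong₂ _++_ (init⋆-⊙-++ xs ys) (wk⋆-⊙-++ xs ys)

  init⋆-++-wk⋆ : ∀ {n n′} k (ρ : Sub (Term 𝔽) n n′) →
                 init⋆ k n′ ++ (ρ ⊙ wk⋆ k) ≡ ρ ↑⋆ k
  init⋆-++-wk⋆      zero    ρ = ⊙-id
  init⋆-++-wk⋆ {n′ = n′} (suc k) ρ = cong (var zero ∷_) (begin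
    tabulate (λ i → var (suc (i ↑ˡ n′))) ++ (ρ ⊙ Vec.map weaken (wk⋆ k))
      ≡⟨ cong₂ _++_ (Vec.tabulate-∘ weaken (λ i → var (i ↑ˡ n′))) lemma ⟩
    Vec.map weaken (init⋆ k n′) ++ Vec.map weaken (ρ ⊙ wk⋆ k)
      ≡⟨ Vec.map-++ weaken (init⋆ k n′) (ρ ⊙ wk⋆ k) ⟨
    Vec.map weaken (init⋆ k n′ ++ (ρ ⊙ wk⋆ k))
      ≡⟨ cong (Vec.map weaken) (init⋆-++-wk⋆ k ρ) ⟩
    Vec.map weaken (ρ ↑⋆ k) ∎)
    where
    open ≡.≡-Reasoning
    lemma : ρ ⊙ Vec.map weaken (wk⋆ k) ≡ Vec.map weaken (ρ ⊙ wk⋆ k)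
    lemma = trans (cong (ρ ⊙_) (map-weaken {ρ = wk⋆ k}))
              (trans (⊙-assoc {ρ₁ = ρ} {wk⋆ k} {wk}) (sym (map-weaken {ρ = ρ ⊙ wk⋆ k})))

-- A morphism from n to k is a k-tuple of terms in n variables. The product
-- of X and Y is the concatenation (X , Y); its last variables, those of Y,
-- have the lowest indices.
Ctx : Signature f → CartesianCategory 0ℓ f f
Ctx 𝔽 = record
  { Obj           = ℕ
  ; Hom           = λ X Y → Sub (Term 𝔽) Y X
  ; _≈_           = _≡_
  ; id            = id
  ; _∘ₘ_          = _⊙_
  ; isEquivalence = ≡.isEquivalence
  ; ∘-cong        = cong₂ _⊙_
  ; ∘-assoc       = λ g h k → sym (⊙-assoc {ρ₁ = g} {h} {k})
  ; ∘-identityˡ   = λ _ → id-⊙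
  ; ∘-identityʳ   = λ _ → ⊙-id
  ; 𝟙             = 0
  ; !             = []
  ; !-unique      = λ { [] → refl }
  ; _×ₒ_          = λ X Y → Y + X
  ; pr₁           = λ {_} {Y} → wk⋆ Y
  ; pr₂           = λ {X} {Y} → init⋆ Y X
  ; ⟨_,_⟩         = λ g h → h ++ g
  ; pr₁-⟨⟩        = λ g h → wk⋆-⊙-++ h g
  ; pr₂-⟨⟩        = λ g h → init⋆-⊙-++ h g
  ; ⟨⟩-unique     = ++-unique
  }
  where open TermSubstitution 𝔽

------------------------------------------------------------------------
-- Formulas, theories and provability

module _ (𝔽 : Signature f) (ℙ : Signature r) where
  open Signature ℙ

  infixr 8 _∧ᶠ_
  infixr 7 _∨ᶠ_
  infixr 6 _⇒ᶠ_
  infix  9 ¬ᶠ_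

  data Formula (n : ℕ) : Set (f ⊔ r) where
    rel       : (R : Symbol) → Vec (Term 𝔽 n) (arity R) → Formula n
    ⊤ᶠ ⊥ᶠ     : Formula n
    _∧ᶠ_ _∨ᶠ_ : Formula n → Formula n → Formula n
    _⇒ᶠ_      : Formula n → Formula n → Formula n
    ¬ᶠ_       : Formula n → Formula n
    ∀ᶠ ∃ᶠ     : Formula (suc n) → Formula n

  data QuantifierFree {n : ℕ} : Pred (Formula n) (f ⊔ r) where
    rel  : ∀ R ts → QuantifierFree (rel R ts)
    ⊤ᶠ   : QuantifierFree ⊤ᶠ
    ⊥ᶠ   : QuantifierFree ⊥ᶠ
    _∧ᶠ_ : ∀ {φ ψ} → QuantifierFree φ → QuantifierFree ψ → QuantifierFree (φ ∧ᶠ ψ)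
    _∨ᶠ_ : ∀ {φ ψ} → QuantifierFree φ → QuantifierFree ψ → QuantifierFree (φ ∨ᶠ ψ)
    _⇒ᶠ_ : ∀ {φ ψ} → QuantifierFree φ → QuantifierFree ψ → QuantifierFree (φ ⇒ᶠ ψ)
    ¬ᶠ_  : ∀ {φ} → QuantifierFree φ → QuantifierFree (¬ᶠ φ)

  Theory : (t : Level) → Set (f ⊔ r ⊔ lsuc t)
  Theory t = Pred (Formula 0) t

module FormulaSubstitution (𝔽 : Signature f) (ℙ : Signature r) where
  private
    module T = TermSubstitution 𝔽
  open T using (id; _⊙_; _↑; _↑⋆_; wk; wk⋆)

  infixl 8 _/_

  _/_ : ∀ {k n} → Formula 𝔽 ℙ k → Sub (Term 𝔽) k n → Formula 𝔽 ℙ n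
  rel R ts / ρ = rel R (Vec.map (T._/ ρ) ts)
  ⊤ᶠ       / ρ = ⊤ᶠ
  ⊥ᶠ       / ρ = ⊥ᶠ
  (φ ∧ᶠ ψ) / ρ = (φ / ρ) ∧ᶠ (ψ / ρ)
  (φ ∨ᶠ ψ) / ρ = (φ / ρ) ∨ᶠ (ψ / ρ)
  (φ ⇒ᶠ ψ) / ρ = (φ / ρ) ⇒ᶠ (ψ / ρ)
  (¬ᶠ φ)   / ρ = ¬ᶠ (φ / ρ)
  ∀ᶠ φ     / ρ = ∀ᶠ (φ / ρ ↑)
  ∃ᶠ φ     / ρ = ∃ᶠ (φ / ρ ↑)

  /-id : ∀ {n} (φ : Formula 𝔽 ℙ n) → φ / id ≡ φ
  /-id (rel R ts) = cong (rel R) (trans (Vec.map-cong T.id-vanishes ts) (Vec.map-id ts))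
  /-id ⊤ᶠ         = refl
  /-id ⊥ᶠ         = refl
  /-id (φ ∧ᶠ ψ)   = cong₂ _∧ᶠ_ (/-id φ) (/-id ψ)
  /-id (φ ∨ᶠ ψ)   = cong₂ _∨ᶠ_ (/-id φ) (/-id ψ)
  /-id (φ ⇒ᶠ ψ)   = cong₂ _⇒ᶠ_ (/-id φ) (/-id ψ)
  /-id (¬ᶠ φ)     = cong ¬ᶠ_ (/-id φ)
  /-id (∀ᶠ φ)     = cong ∀ᶠ (/-id φ)
  /-id (∃ᶠ φ)     = cong ∃ᶠ (/-id φ)

  /-⊙ : ∀ {k n l} {ρ₁ : Sub (Term 𝔽) k n} {ρ₂ : Sub (Term 𝔽) n l} (φ : Formula 𝔽 ℙ k) →
        φ / (ρ₁ ⊙ ρ₂) ≡ φ / ρ₁ / ρ₂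
  /-⊙ (rel R ts) = cong (rel R) (trans (Vec.map-cong T./-⊙ ts) (Vec.map-∘ _ _ ts))
  /-⊙ ⊤ᶠ         = refl
  /-⊙ ⊥ᶠ         = refl
  /-⊙ (φ ∧ᶠ ψ)   = cong₂ _∧ᶠ_ (/-⊙ φ) (/-⊙ ψ)
  /-⊙ (φ ∨ᶠ ψ)   = cong₂ _∨ᶠ_ (/-⊙ φ) (/-⊙ ψ)
  /-⊙ (φ ⇒ᶠ ψ)   = cong₂ _⇒ᶠ_ (/-⊙ φ) (/-⊙ ψ)
  /-⊙ (¬ᶠ φ)     = cong ¬ᶠ_ (/-⊙ φ)
  /-⊙ (∀ᶠ φ)     = cong ∀ᶠ (trans (cong (φ /_) (T.↑⋆-distrib 1)) (/-⊙ φ))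
  /-⊙ (∃ᶠ φ)     = cong ∃ᶠ (trans (cong (φ /_) (T.↑⋆-distrib 1)) (/-⊙ φ))

  appLemmas : AppLemmas (Formula 𝔽 ℙ) (Term 𝔽)
  appLemmas = record
    { application = record { _/_ = _/_ }
    ; lemmas₄     = T.lemmas₄
    ; id-vanishes = /-id
    ; /-⊙         = /-⊙
    }

  open AppLemmas appLemmas public
    using (wk-commutes; sub-commutes; wk-sub-vanishes; /-weaken)

  wk-/-∷ : ∀ {k n} (φ : Formula 𝔽 ℙ k) u (ρ : Sub (Term 𝔽) k n) →
           φ / wk / (u ∷ ρ) ≡ φ / ρ
  wk-/-∷ φ u ρ = trans (sym (/-⊙ φ))
    (cong (φ /_) (trans (T.map-weaken-⊙-∷ id u ρ) T.id-⊙))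

  infixl 8 _/ˡ_

  _/ˡ_ : ∀ {k n} → List (Formula 𝔽 ℙ k) → Sub (Term 𝔽) k n → List (Formula 𝔽 ℙ n)
  Γ /ˡ ρ = List.map (_/ ρ) Γ

  wk-/ˡ-∷ : ∀ {k n} (Γ : List (Formula 𝔽 ℙ k)) u (ρ : Sub (Term 𝔽) k n) →
            Γ /ˡ wk /ˡ (u ∷ ρ) ≡ Γ /ˡ ρ
  wk-/ˡ-∷ Γ u ρ = trans (sym (List.map-∘ Γ)) (List.map-cong (λ φ → wk-/-∷ φ u ρ) Γ)

  wk-commutesˡ : ∀ {k n} (Γ : List (Formula 𝔽 ℙ k)) (ρ : Sub (Term 𝔽) k n) →
                 Γ /ˡ wk /ˡ ρ ↑ ≡ Γ /ˡ ρ /ˡ wk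
  wk-commutesˡ Γ ρ = trans (sym (List.map-∘ Γ))
    (trans (List.map-cong (λ φ → sym (wk-commutes φ)) Γ) (List.map-∘ Γ))

  -- Universal quantification over the last k variables of the context.
  ∀ᶠ⋆ : ∀ k {n} → Formula 𝔽 ℙ (k + n) → Formula 𝔽 ℙ n
  ∀ᶠ⋆ zero    φ = φ
  ∀ᶠ⋆ (suc k) φ = ∀ᶠ⋆ k (∀ᶠ φ)

  ∀ᶠ⋆-/ : ∀ k {n l} (φ : Formula 𝔽 ℙ (k + n)) (ρ : Sub (Term 𝔽) n l) →
          ∀ᶠ⋆ k φ / ρ ≡ ∀ᶠ⋆ k (φ / ρ ↑⋆ k)
  ∀ᶠ⋆-/ zero    φ ρ = refl
  ∀ᶠ⋆-/ (suc k) φ ρ = ∀ᶠ⋆-/ k (∀ᶠ φ) ρ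

module Provability (𝔽 : Signature f) (ℙ : Signature r) (𝒯 : Theory 𝔽 ℙ t) where
  open TermSubstitution 𝔽 using (id; wk; wk⋆; sub; _↑; id-⊙)
  open FormulaSubstitution 𝔽 ℙ

  infix 3 _⊢_

  -- Γ ⊢ Δ at index n is derivability from 𝒯 of the sequent Γ ⇒ Δ in the
  -- context of length n. The premises of the quantifier rules with an
  -- eigenvariable, and the conclusion of enlarge, live in context suc n, where
  -- the formulas of the smaller context are weakened. As sequents are
  -- considered up to exchange, principal formulas are put first on both sides.
  -- The left rule for ⊤ and the right rule for ⊥ are instances of weakening.
  data _⊢_ : ∀ {n} → List (Formula 𝔽 ℙ n) → List (Formula 𝔽 ℙ n) → Set (f ⊔ r ⊔ t) where
    axiom    : ∀ {φ} → φ ∈ 𝒯 → [] ⊢ [ φ ]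
    identity : ∀ {n} {φ : Formula 𝔽 ℙ n} → [ φ ] ⊢ [ φ ]
    cut      : ∀ {n} {Γ Δ} (φ : Formula 𝔽 ℙ n) → Γ ⊢ φ ∷ Δ → φ ∷ Γ ⊢ Δ → Γ ⊢ Δ
    weakenL  : ∀ {n} {Γ Δ} {φ : Formula 𝔽 ℙ n} → Γ ⊢ Δ → φ ∷ Γ ⊢ Δ
    weakenR  : ∀ {n} {Γ Δ} {φ : Formula 𝔽 ℙ n} → Γ ⊢ Δ → Γ ⊢ φ ∷ Δ
    contrL   : ∀ {n} {Γ Δ} {φ : Formula 𝔽 ℙ n} → φ ∷ φ ∷ Γ ⊢ Δ → φ ∷ Γ ⊢ Δ
    contrR   : ∀ {n} {Γ Δ} {φ : Formula 𝔽 ℙ n} → Γ ⊢ φ ∷ φ ∷ Δ → Γ ⊢ φ ∷ Δ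
    exchL    : ∀ {n} {Γ Γ′ Δ : List (Formula 𝔽 ℙ n)} → Γ ↭ Γ′ → Γ ⊢ Δ → Γ′ ⊢ Δ
    exchR    : ∀ {n} {Γ Δ Δ′ : List (Formula 𝔽 ℙ n)} → Δ ↭ Δ′ → Γ ⊢ Δ → Γ ⊢ Δ′
    ⊤R       : ∀ {n} {Γ Δ : List (Formula 𝔽 ℙ n)} → Γ ⊢ ⊤ᶠ ∷ Δ
    ⊥L       : ∀ {n} {Γ Δ : List (Formula 𝔽 ℙ n)} → ⊥ᶠ ∷ Γ ⊢ Δ
    ∧L       : ∀ {n} {Γ Δ} {φ ψ : Formula 𝔽 ℙ n} → φ ∷ ψ ∷ Γ ⊢ Δ → φ ∧ᶠ ψ ∷ Γ ⊢ Δ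
    ∧R       : ∀ {n} {Γ Δ} {φ ψ : Formula 𝔽 ℙ n} → Γ ⊢ φ ∷ Δ → Γ ⊢ ψ ∷ Δ → Γ ⊢ φ ∧ᶠ ψ ∷ Δ
    ∨L       : ∀ {n} {Γ Δ} {φ ψ : Formula 𝔽 ℙ n} → φ ∷ Γ ⊢ Δ → ψ ∷ Γ ⊢ Δ → φ ∨ᶠ ψ ∷ Γ ⊢ Δ
    ∨R       : ∀ {n} {Γ Δ} {φ ψ : Formula 𝔽 ℙ n} → Γ ⊢ φ ∷ ψ ∷ Δ → Γ ⊢ φ ∨ᶠ ψ ∷ Δ
    ¬L       : ∀ {n} {Γ Δ} {φ : Formula 𝔽 ℙ n} → Γ ⊢ φ ∷ Δ → ¬ᶠ φ ∷ Γ ⊢ Δ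
    ¬R       : ∀ {n} {Γ Δ} {φ : Formula 𝔽 ℙ n} → φ ∷ Γ ⊢ Δ → Γ ⊢ ¬ᶠ φ ∷ Δ
    ⇒L       : ∀ {n} {Γ Δ} {φ ψ : Formula 𝔽 ℙ n} → Γ ⊢ φ ∷ Δ → ψ ∷ Γ ⊢ Δ → φ ⇒ᶠ ψ ∷ Γ ⊢ Δ
    ⇒R       : ∀ {n} {Γ Δ} {φ ψ : Formula 𝔽 ℙ n} → φ ∷ Γ ⊢ ψ ∷ Δ → Γ ⊢ φ ⇒ᶠ ψ ∷ Δ
    enlarge  : ∀ {n} {Γ Δ : List (Formula 𝔽 ℙ n)} → Γ ⊢ Δ → Γ /ˡ wk ⊢ Δ /ˡ wk
    ∀L       : ∀ {n} {Γ Δ} {ζ : Formula 𝔽 ℙ (suc n)} (s : Term 𝔽 n) →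
               ζ / sub s ∷ Γ ⊢ Δ → ∀ᶠ ζ ∷ Γ ⊢ Δ
    ∀R       : ∀ {n} {Γ Δ} {ζ : Formula 𝔽 ℙ (suc n)} →
               Γ /ˡ wk ⊢ ζ ∷ Δ /ˡ wk → Γ ⊢ ∀ᶠ ζ ∷ Δ
    ∃L       : ∀ {n} {Γ Δ} {ζ : Formula 𝔽 ℙ (suc n)} →
               ζ ∷ Γ /ˡ wk ⊢ Δ /ˡ wk → ∃ᶠ ζ ∷ Γ ⊢ Δ
    ∃R       : ∀ {n} {Γ Δ} {ζ : Formula 𝔽 ℙ (suc n)} (s : Term 𝔽 n) →
               Γ ⊢ ζ / sub s ∷ Δ → Γ ⊢ ∃ᶠ ζ ∷ Δ

  ⊢-axiom : ∀ {φ} → φ ∈ 𝒯 → ∀ {n} (ρ : Sub (Term 𝔽) 0 n) → [] ⊢ [ φ / ρ ]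
  ⊢-axiom {φ} φ∈𝒯 {zero}  []  = subst (λ ψ → [] ⊢ [ ψ ]) (sym (/-id φ)) (axiom φ∈𝒯)
  ⊢-axiom {φ} φ∈𝒯 {suc n} []  =
    subst (λ ψ → [] ⊢ [ ψ ]) (sym (/-weaken φ)) (enlarge (⊢-axiom {φ} φ∈𝒯 []))

  ⊢-/ : ∀ {k n} {Γ Δ : List (Formula 𝔽 ℙ k)} → Γ ⊢ Δ →
        (ρ : Sub (Term 𝔽) k n) → Γ /ˡ ρ ⊢ Δ /ˡ ρ
  ⊢-/ (axiom {φ} p) ρ = ⊢-axiom {φ} p ρ
  ⊢-/ identity      ρ = identity
  ⊢-/ (cut φ d d′)  ρ = cut (φ / ρ) (⊢-/ d ρ) (⊢-/ d′ ρ)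
  ⊢-/ (weakenL d)   ρ = weakenL (⊢-/ d ρ)
  ⊢-/ (weakenR d)   ρ = weakenR (⊢-/ d ρ)
  ⊢-/ (contrL d)    ρ = contrL (⊢-/ d ρ)
  ⊢-/ (contrR d)    ρ = contrR (⊢-/ d ρ)
  ⊢-/ (exchL p d)   ρ = exchL (map⁺ (_/ ρ) p) (⊢-/ d ρ)
  ⊢-/ (exchR p d)   ρ = exchR (map⁺ (_/ ρ) p) (⊢-/ d ρ)
  ⊢-/ ⊤R            ρ = ⊤R
  ⊢-/ ⊥L            ρ = ⊥L
  ⊢-/ (∧L d)        ρ = ∧L (⊢-/ d ρ)
  ⊢-/ (∧R d d′)     ρ = ∧R (⊢-/ d ρ) (⊢-/ d′ ρ)
  ⊢-/ (∨L d d′)     ρ = ∨L (⊢-/ d ρ) (⊢-/ d′ ρ)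
  ⊢-/ (∨R d)        ρ = ∨R (⊢-/ d ρ)
  ⊢-/ (¬L d)        ρ = ¬L (⊢-/ d ρ)
  ⊢-/ (¬R d)        ρ = ¬R (⊢-/ d ρ)
  ⊢-/ (⇒L d d′)     ρ = ⇒L (⊢-/ d ρ) (⊢-/ d′ ρ)
  ⊢-/ (⇒R d)        ρ = ⇒R (⊢-/ d ρ)
  ⊢-/ (enlarge {Γ = Γ} {Δ} d) (u ∷ ρ) =
    subst₂ _⊢_ (sym (wk-/ˡ-∷ Γ u ρ)) (sym (wk-/ˡ-∷ Δ u ρ)) (⊢-/ d ρ)
  ⊢-/ (∀L {Γ = Γ} {Δ} {ζ} s d) ρ =
    ∀L (s T./ ρ) (subst (λ ψ → ψ ∷ Γ /ˡ ρ ⊢ Δ /ˡ ρ) (sub-commutes ζ) (⊢-/ d ρ))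
    where module T = TermSubstitution 𝔽
  ⊢-/ (∀R {Γ = Γ} {Δ} {ζ} d) ρ =
    ∀R (subst₂ (λ Γ′ Δ′ → Γ′ ⊢ ζ / ρ ↑ ∷ Δ′) (wk-commutesˡ Γ ρ) (wk-commutesˡ Δ ρ) (⊢-/ d (ρ ↑)))
  ⊢-/ (∃L {Γ = Γ} {Δ} {ζ} d) ρ =
    ∃L (subst₂ (λ Γ′ Δ′ → ζ / ρ ↑ ∷ Γ′ ⊢ Δ′) (wk-commutesˡ Γ ρ) (wk-commutesˡ Δ ρ) (⊢-/ d (ρ ↑)))
  ⊢-/ (∃R {Γ = Γ} {Δ} {ζ} s d) ρ =
    ∃R (s T./ ρ) (subst (λ ψ → Γ /ˡ ρ ⊢ ψ ∷ Δ /ˡ ρ) (sub-commutes ζ) (⊢-/ d ρ))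
    where module T = TermSubstitution 𝔽

  infix 4 _≤ᶠ_ _≈ᶠ_

  _≤ᶠ_ _≈ᶠ_ : ∀ {n} → Rel (Formula 𝔽 ℙ n) (f ⊔ r ⊔ t)
  φ ≤ᶠ ψ = [ φ ] ⊢ [ ψ ]
  φ ≈ᶠ ψ = φ ≤ᶠ ψ × ψ ≤ᶠ φ

  ≤ᶠ-trans : ∀ {n} {φ ψ χ : Formula 𝔽 ℙ n} → φ ≤ᶠ ψ → ψ ≤ᶠ χ → φ ≤ᶠ χ
  ≤ᶠ-trans {ψ = ψ} d d′ =
    cut ψ (exchR (↭-swap _ _ ↭-refl) (weakenR d)) (exchL (↭-swap _ _ ↭-refl) (weakenL d′))

  ≡⇒≈ᶠ : ∀ {n} {φ ψ : Formula 𝔽 ℙ n} → φ ≡ ψ → φ ≈ᶠ ψ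
  ≡⇒≈ᶠ refl = identity , identity

  identityˡ : ∀ {n} {φ ψ : Formula 𝔽 ℙ n} → φ ∷ ψ ∷ [] ⊢ [ φ ]
  identityˡ = exchL (↭-swap _ _ ↭-refl) (weakenL identity)

  identityʳ : ∀ {n} {φ ψ : Formula 𝔽 ℙ n} → [ φ ] ⊢ φ ∷ ψ ∷ []
  identityʳ = exchR (↭-swap _ _ ↭-refl) (weakenR identity)

  ≤ᶠ-isPartialOrder : ∀ {n} → IsPartialOrder (_≈ᶠ_ {n}) _≤ᶠ_
  ≤ᶠ-isPartialOrder = record
    { isPreorder = record
      { isEquivalence = record
        { refl  = identity , identity
        ; sym   = λ (d , d′) → d′ , d
        ; trans = λ (d , d′) (b , b′) → ≤ᶠ-trans d b , ≤ᶠ-trans b′ d′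
        }
      ; reflexive = proj₁
      ; trans     = ≤ᶠ-trans
      }
    ; antisym = _,_
    }

  ⇨-intro : ∀ {n} {φ ψ χ : Formula 𝔽 ℙ n} → φ ∧ᶠ ψ ≤ᶠ χ → φ ≤ᶠ ¬ᶠ ψ ∨ᶠ χ
  ⇨-intro {φ = φ} {ψ} d = ∨R (¬R (cut (φ ∧ᶠ ψ)
    (∧R (weakenL (exchR (↭-swap _ _ ↭-refl) (weakenR identity)))
        (exchL (↭-swap _ _ ↭-refl) (weakenL identityʳ)))
    (exchL (_↭_.trans (↭-swap _ _ ↭-refl) (_↭_.prep _ (↭-swap _ _ ↭-refl)))
      (weakenL (exchL (↭-swap _ _ ↭-refl) (weakenL d))))))

  ⇨-elim : ∀ {n} {φ ψ χ : Formula 𝔽 ℙ n} → φ ≤ᶠ ¬ᶠ ψ ∨ᶠ χ → φ ∧ᶠ ψ ≤ᶠ χ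
  ⇨-elim {φ = φ} {ψ} {χ} d = ∧L (cut (¬ᶠ ψ ∨ᶠ χ)
    (exchR (↭-swap _ _ ↭-refl) (weakenR (exchL (↭-swap _ _ ↭-refl) (weakenL d))))
    (∨L (¬L (weakenL (identityʳ)))
        (exchL (↭-swap _ _ ↭-refl) (weakenL identityˡ))))

  -- The poset reflection is taken by letting _≈ᶠ_ be the equality.
  formulas : ℕ → BooleanAlgebra (f ⊔ r) (f ⊔ r ⊔ t) (f ⊔ r ⊔ t)
  formulas n = record
    { Carrier = Formula 𝔽 ℙ n
    ; _≈_     = _≈ᶠ_
    ; _≤_     = _≤ᶠ_
    ; _∨_     = _∨ᶠ_
    ; _∧_     = _∧ᶠ_
    ; ¬_      = ¬ᶠ_
    ; ⊤       = ⊤ᶠ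
    ; ⊥       = ⊥ᶠ
    ; isBooleanAlgebra = record
      { isHeytingAlgebra = record
        { isBoundedLattice = record
          { isLattice = record
            { isPartialOrder = ≤ᶠ-isPartialOrder
            ; supremum       = λ φ ψ → ∨R identityʳ , ∨R (weakenR identity) , λ χ → ∨L
            ; infimum        = λ φ ψ → ∧L identityˡ , ∧L (weakenL identity) , λ χ → ∧R
            }
          ; maximum = λ φ → ⊤R
          ; minimum = λ φ → ⊥L
          }
        ; exponential = λ φ ψ χ → ⇨-intro , ⇨-elim
        }
      }
    }

  ∀ᶠ-intro : ∀ {n} {φ : Formula 𝔽 ℙ n} {ψ} → φ / wk ≤ᶠ ψ → φ ≤ᶠ ∀ᶠ ψ
  ∀ᶠ-intro = ∀R

  ∀ᶠ-elim : ∀ {n} {φ : Formula 𝔽 ℙ n} {ψ} → φ ≤ᶠ ∀ᶠ ψ → φ / wk ≤ᶠ ψ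
  ∀ᶠ-elim {φ = φ} {ψ} d = ≤ᶠ-trans (enlarge d)
    (∀L (var zero) (subst (λ χ → [ χ ] ⊢ [ ψ ]) (sym lemma) identity))
    where
    lemma : ψ / wk ↑ / sub (var zero) ≡ ψ
    lemma = trans (sym (/-⊙ ψ)) (trans (cong (ψ /_) lemma′) (/-id ψ))
      where
      open TermSubstitution 𝔽 using (_⊙_; map-weaken-⊙-∷; ⊙-id)
      lemma′ : wk ↑ ⊙ sub (var zero) ≡ id
      lemma′ = cong (var zero ∷_) (trans (map-weaken-⊙-∷ wk (var zero) id) ⊙-id)

  ∀ᶠ⋆-intro : ∀ k {n} {φ : Formula 𝔽 ℙ n} {ψ} → φ / wk⋆ k ≤ᶠ ψ → φ ≤ᶠ ∀ᶠ⋆ k ψ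
  ∀ᶠ⋆-intro zero    {φ = φ} {ψ} d = subst (_≤ᶠ ψ) (/-id φ) d
  ∀ᶠ⋆-intro (suc k) {φ = φ} {ψ} d =
    ∀ᶠ⋆-intro k (∀ᶠ-intro (subst (_≤ᶠ ψ) (/-weaken φ) d))

  ∀ᶠ⋆-elim : ∀ k {n} {φ : Formula 𝔽 ℙ n} {ψ} → φ ≤ᶠ ∀ᶠ⋆ k ψ → φ / wk⋆ k ≤ᶠ ψ
  ∀ᶠ⋆-elim zero    {φ = φ} {ψ} d = subst (_≤ᶠ ψ) (sym (/-id φ)) d
  ∀ᶠ⋆-elim (suc k) {φ = φ} {ψ} d =
    subst (_≤ᶠ ψ) (sym (/-weaken φ)) (∀ᶠ-elim (∀ᶠ⋆-elim k d))

------------------------------------------------------------------------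
-- The syntactic doctrine

module _ (𝔽 : Signature f) (ℙ : Signature r) (𝒯 : Theory 𝔽 ℙ t) where
  open TermSubstitution 𝔽 using (init⋆-++-wk⋆)
  open FormulaSubstitution 𝔽 ℙ
  open Provability 𝔽 ℙ 𝒯

  LT : FirstOrderBooleanDoctrine (Ctx 𝔽) (f ⊔ r) (f ⊔ r ⊔ t) (f ⊔ r ⊔ t)
  LT = record
    { booleanDoctrine = record
      { fibre        = formulas
      ; reindex      = λ ρ φ → φ / ρ
      ; reindex-homo = λ ρ → record
        { cong-≈ = λ (d , d′) → ⊢-/ d ρ , ⊢-/ d′ ρ
        ; ⊤-homo = ≡⇒≈ᶠ refl
        ; ⊥-homo = ≡⇒≈ᶠ refl
        ; ∧-homo = λ φ ψ → ≡⇒≈ᶠ refl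
        ; ∨-homo = λ φ ψ → ≡⇒≈ᶠ refl
        ; ¬-homo = λ φ → ≡⇒≈ᶠ refl
        }
      ; reindex-cong = λ ρ≡ρ′ φ → ≡⇒≈ᶠ (cong (φ /_) ρ≡ρ′)
      ; reindex-id   = λ φ → ≡⇒≈ᶠ (/-id φ)
      ; reindex-∘    = λ ρ ρ′ φ → ≡⇒≈ᶠ (/-⊙ φ)
      }
    ; all            = λ X Y → ∀ᶠ⋆ Y
    ; all-mono       = λ X Y d → ∀ᶠ⋆-intro Y (≤ᶠ-trans (∀ᶠ⋆-elim Y identity) d)
    ; all-adjoint    = λ X Y → ∀ᶠ⋆-intro Y , ∀ᶠ⋆-elim Y
    ; beck-chevalley = λ ρ Y φ → ≡⇒≈ᶠ (trans (∀ᶠ⋆-/ Y φ ρ)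
        (cong (λ ρ′ → ∀ᶠ⋆ Y (φ / ρ′)) (sym (init⋆-++-wk⋆ Y ρ))))
    }

  -- φ represents the class of some quantifier-free formula.
  LT₀ : ∀ X → Pred (Formula 𝔽 ℙ X) (f ⊔ r ⊔ t)
  LT₀ X φ = Σ[ ψ ∈ Formula 𝔽 ℙ X ] (QuantifierFree 𝔽 ℙ ψ × φ ≈ᶠ ψ)

{-# OPTIONS --safe #-}
module Submission where

open import Data.List.Base using (List; []; _∷_; [_])
open import Data.List.Relation.Binary.Permutation.Propositional using (↭-refl; ↭-swap; ↭-sym)
open import Data.List.Relation.Binary.Permutation.Propositional.Properties using (All-resp-↭)
open import Data.List.Relation.Unary.All as All using (All; []; _∷_)
import Data.List.Relation.Unary.All.Properties as All
open import Data.Nat.Base using (ℕ; zero; suc; _+_)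
open import Data.Product.Base using (Σ-syntax; _,_; proj₁; proj₂)
open import Function.Bundles using (_⇔_; mk⇔)
open import Level using (Level; _⊔_; lift)
open import Relation.Binary.Lattice.Bundles using (BooleanAlgebra)
import Relation.Binary.Lattice.Properties.HeytingAlgebra as HeytingProperties
import Relation.Binary.Lattice.Properties.JoinSemilattice as JoinProperties
import Relation.Binary.Lattice.Properties.MeetSemilattice as MeetProperties
open import Relation.Binary.PropositionalEquality as ≡ using (refl)
open import Relation.Unary using (Pred; _∈_)
open import Defs

-- The predicate symbols of arity n are the elements of P₀(n), and 𝒯 consists of
-- the closed formulas whose interpretation in P is ⊤. The interpretation of
-- formulas in P is sound; it reflects the order, since φ ≤ ψ in P(n) puts the
-- universal closure of φ ⇒ ψ in 𝒯; and it is surjective, since every element of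
-- P(n) arises from elements of P₀ by finitely many Boolean operations and
-- quantifications. Hence it is an isomorphism over the identity of the category
-- of contexts.

private
  variable
    o m e f c c′ ℓ₁ ℓ₁′ ℓ₂ ℓ₂′ p : Level

-- Order-theoretic calculus in Boolean algebras.

module BooleanProperties (B : BooleanAlgebra c ℓ₁ ℓ₂) where
  open BooleanAlgebra B
  open HeytingProperties heytingAlgebra using (∧-distribˡ-∨-≤)

  -- Since `x ⇨ y` is by definition `¬ x ∨ y`, this and `¬x∧x≤⊥` are the exponential adjunction
  -- applied to a projection and to an injection.
  ≤-excluded-middle : ∀ {x z} → x ≤ ¬ z ∨ z
  ≤-excluded-middle = transpose-⇨ (x∧y≤y _ _)

  ¬x∧x≤⊥ : ∀ {x} → ¬ x ∧ x ≤ ⊥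
  ¬x∧x≤⊥ = transpose-∧ (x≤x∨y _ _)

  x∨⊥≤x : ∀ {x} → x ∨ ⊥ ≤ x
  x∨⊥≤x = ∨-least (reflexive Eq.refl) (minimum _)

  -- By distributivity, `x` lies below `(x ∧ z) ∨ (x ∧ y)`. This algebraic form of cut serves as the
  -- case distinction on `z` in the soundness proof.
  ≤-cut : ∀ {x y} z → x ≤ z ∨ y → x ∧ z ≤ y → x ≤ y
  ≤-cut z x≤z∨y x∧z≤y = trans (∧-greatest (reflexive Eq.refl) x≤z∨y)
    (trans (∧-distribˡ-∨-≤ _ _ _) (∨-least x∧z≤y (x∧y≤y _ _)))

  x∧¬z≤y⇒x≤z∨y : ∀ {x y z} → x ∧ ¬ z ≤ y → x ≤ z ∨ y
  x∧¬z≤y⇒x≤z∨y {z = z} h = ≤-cut (¬ z)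
    (trans ≤-excluded-middle (∨-least (x≤x∨y _ _) (trans (x≤x∨y _ _) (y≤x∨y _ _))))
    (trans h (y≤x∨y _ _))

  x≤z∨y⇒x∧¬z≤y : ∀ {x y z} → x ≤ z ∨ y → x ∧ ¬ z ≤ y
  x≤z∨y⇒x∧¬z≤y {z = z} h = ≤-cut z (trans (x∧y≤x _ _) h)
    (trans (∧-greatest (trans (x∧y≤x _ _) (x∧y≤y _ _)) (x∧y≤y _ _))
      (trans ¬x∧x≤⊥ (minimum _)))

  ¬x≤y⇒¬y≤x : ∀ {x y} → ¬ x ≤ y → ¬ y ≤ x
  ¬x≤y⇒¬y≤x h = trans (x∧¬z≤y⇒x≤z∨y
    (trans (∧-greatest (x∧y≤x _ _) (trans (x∧y≤y _ _) h)) ¬x∧x≤⊥)) x∨⊥≤x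

  x≤¬y⇒y≤¬x : ∀ {x y} → x ≤ ¬ y → y ≤ ¬ x
  x≤¬y⇒y≤¬x h = trans (transpose-⇨
    (trans (∧-greatest (trans (x∧y≤y _ _) h) (x∧y≤x _ _)) ¬x∧x≤⊥)) x∨⊥≤x

  ¬-antitone : ∀ {x y} → x ≤ y → ¬ y ≤ ¬ x
  ¬-antitone h = x≤¬y⇒y≤¬x (trans h (x≤¬y⇒y≤¬x (reflexive Eq.refl)))

  ¬-cong : ∀ {x y} → x ≈ y → ¬ x ≈ ¬ y
  ¬-cong x≈y = antisym (¬-antitone (reflexive (Eq.sym x≈y))) (¬-antitone (reflexive x≈y))

  open JoinProperties joinSemilattice public using (∨-cong)
  open MeetProperties meetSemilattice public using (∧-cong)

-- Homomorphisms are given by equations only; the order is recovered from `x ≈ x ∧ y`.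
boolean-mono : {A : BooleanAlgebra c ℓ₁ ℓ₂} {B : BooleanAlgebra c′ ℓ₁′ ℓ₂′}
               {h : BooleanAlgebra.Carrier A → BooleanAlgebra.Carrier B} →
               IsBooleanHomomorphism A B h →
               ∀ {x y} → BooleanAlgebra._≤_ A x y → BooleanAlgebra._≤_ B (h x) (h y)
boolean-mono {A = A} {B} h-homo x≤y =
  B.trans (B.reflexive (cong-≈ (A.antisym (A.∧-greatest (A.reflexive A.Eq.refl) x≤y) (A.x∧y≤x _ _))))
    (B.trans (B.reflexive (∧-homo _ _)) (B.x∧y≤y _ _))
  where
  module A = BooleanAlgebra A
  module B = BooleanAlgebra B
  open IsBooleanHomomorphism h-homo

Generated-least : {A : BooleanAlgebra c ℓ₁ ℓ₂} {S : Pred (BooleanAlgebra.Carrier A) p}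
                  {T : Pred (BooleanAlgebra.Carrier A) e} → IsSubalgebra A T →
                  (∀ {x} → x ∈ S → x ∈ T) → ∀ {x} → x ∈ Generated A S → x ∈ T
Generated-least {A = A} {S} {T} T-sub S⊆T = go
  where
  module T = IsSubalgebra T-sub
  go : ∀ {x} → x ∈ Generated A S → x ∈ T
  go (generator h)      = S⊆T h
  go (respects-≈ x≈y h) = T.respects-≈ x≈y (go h)
  go ⊤-closed           = T.⊤-closed
  go ⊥-closed           = T.⊥-closed
  go (∧-closed h k)     = T.∧-closed (go h) (go k)
  go (∨-closed h k)     = T.∨-closed (go h) (go k)
  go (¬-closed h)       = T.¬-closed (go h)

-- Quantifiers in a first-order Boolean doctrine.

module DoctrineProperties {C : CartesianCategory o m e}
                          (P : FirstOrderBooleanDoctrine C c ℓ₁ ℓ₂) where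
  open CartesianCategory C using (Obj; Hom; _×ₒ_; pr₁; _×id_)
  open FirstOrderBooleanDoctrine P public
  module FibreProperties X = BooleanProperties (fibre X)
  private
    module FP = FibreProperties

  module _ {X Y : Obj} (g : Hom X Y) where
    open IsBooleanHomomorphism (reindex-homo g) public using () renaming
      ( cong-≈ to reindex-cong-≈; ⊤-homo to reindex-⊤; ⊥-homo to reindex-⊥
      ; ∧-homo to reindex-∧; ∨-homo to reindex-∨; ¬-homo to reindex-¬ )

    reindex-mono : ∀ {α β} → Fibre._≤_ Y α β → Fibre._≤_ X (reindex g α) (reindex g β)
    reindex-mono = boolean-mono (reindex-homo g)

  module _ (X Y : Obj) where
    private
      module X = Fibre X
      module XY = Fibre (X ×ₒ Y)

    all-intro : ∀ {α β} → reindex pr₁ α XY.≤ β → α X.≤ all X Y β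
    all-intro = proj₁ (all-adjoint X Y)

    all-elim : ∀ {α β} → α X.≤ all X Y β → reindex pr₁ α XY.≤ β
    all-elim = proj₂ (all-adjoint X Y)

    all-counit : ∀ {β} → reindex pr₁ (all X Y β) XY.≤ β
    all-counit = all-elim (X.reflexive X.Eq.refl)

    all-cong : ∀ {α β} → α XY.≈ β → all X Y α X.≈ all X Y β
    all-cong α≈β = X.antisym (all-mono X Y (XY.reflexive α≈β))
                             (all-mono X Y (XY.reflexive (XY.Eq.sym α≈β)))

    -- The existential quantifier, obtained from `all` by duality. By `some-unit` and `some-least`
    -- it is left adjoint to reindexing along `pr₁`.
    some : XY.Carrier → X.Carrier
    some β = X.¬ all X Y (XY.¬ β)

    some-unit : ∀ {β} → β XY.≤ reindex pr₁ (some β)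
    some-unit = XY.trans (FP.x≤¬y⇒y≤¬x (X ×ₒ Y) all-counit)
                         (XY.reflexive (XY.Eq.sym (reindex-¬ pr₁ _)))

    some-least : ∀ {α β} → β XY.≤ reindex pr₁ α → some β X.≤ α
    some-least h = FP.¬x≤y⇒¬y≤x X (all-intro
      (XY.trans (XY.reflexive (reindex-¬ pr₁ _)) (FP.¬-antitone (X ×ₒ Y) h)))

  some-reindex : ∀ {X′ X} (g : Hom X′ X) Y (β : Fibre.Carrier (X ×ₒ Y)) →
    Fibre._≈_ X′ (reindex g (some X Y β))
                 (some X′ Y (reindex (g ×id Y) β))
  some-reindex {X′} {X} g Y β = X′.Eq.trans (reindex-¬ g _)
    (FP.¬-cong X′ (X′.Eq.trans (beck-chevalley g Y _) (all-cong X′ Y (reindex-¬ _ β))))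
    where module X′ = Fibre X′

-- Quantification over blocks of variables.

module ContextDoctrine (𝔽 : Signature f) (P : FirstOrderBooleanDoctrine (Ctx 𝔽) c ℓ₁ ℓ₂) where
  open DoctrineProperties P
  open CartesianCategory (Ctx 𝔽) using (pr₁)
  open TermSubstitution 𝔽 using (wk⋆; map-weaken)

  -- The projection that drops no variable is the identity, and so is its adjoint.
  all-zero : ∀ X α → Fibre._≈_ X (all X 0 α) α
  all-zero X α = X.antisym
    (X.trans (X.reflexive (X.Eq.sym (reindex-id _))) (all-counit X 0))
    (all-intro X 0 (X.reflexive (reindex-id α)))
    where module X = Fibre X

  -- The projection dropping `suc Y` variables factors as one dropping a single variable followed by
  -- one dropping `Y`; right adjoints of composites compose.
  all-suc : ∀ X Y α → Fibre._≈_ X (all X (suc Y) α) (all X Y (all (Y + X) 1 α))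
  all-suc X Y α = X.antisym
    (all-intro X Y (all-intro (Y + X) 1
      (Y+X+1.trans (Y+X+1.reflexive (Y+X+1.Eq.sym (pr₁-suc _))) (all-counit X (suc Y)))))
    (all-intro X (suc Y)
      (Y+X+1.trans (Y+X+1.reflexive (pr₁-suc _))
        (all-elim (Y + X) 1 (all-counit X Y))))
    where
    module X = Fibre X
    module Y+X+1 = Fibre (suc Y + X)

    pr₁-suc : ∀ β → reindex (pr₁ {X} {suc Y}) β Y+X+1.≈
                    reindex (pr₁ {Y + X} {1}) (reindex (pr₁ {X} {Y}) β)
    pr₁-suc β = Y+X+1.Eq.trans (reindex-cong (map-weaken {ρ = wk⋆ Y}) β)
                               (reindex-∘ (pr₁ {X} {Y}) (pr₁ {Y + X} {1}) β)

-- The language of the fragment and its interpretation.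

module FragmentLanguage (𝔽 : Signature f) (P : FirstOrderBooleanDoctrine (Ctx 𝔽) c ℓ₁ ℓ₂)
                        (F : QuantifierFreeFragment P p) where
  open DoctrineProperties P
  open ContextDoctrine 𝔽 P
  open QuantifierFreeFragment F
  open CartesianCategory (Ctx 𝔽) using (Hom; pr₁; pr₂)
  open TermSubstitution 𝔽
    using (id; wk; sub; _↑; map-weaken-⊙-∷; id-⊙; ⊙-id; init⋆-++-wk⋆; ++-unique)

  -- Each symbol carries its proof of membership in `P₀`, from which `quantifierFree⇒P₀` treats
  -- atoms. Elements equal up to `≈` may give distinct symbols; `𝒯` makes the corresponding atoms
  -- equivalent.
  ℙ : Signature (c ⊔ p)
  ℙ = record { Symbol = Σ[ n ∈ ℕ ] Σ[ α ∈ Fibre.Carrier n ] α ∈ P₀ n ; arity = proj₁ }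

  open FormulaSubstitution 𝔽 ℙ

  private
    module FP = FibreProperties

  ⟦_⟧ : ∀ {n} → Formula 𝔽 ℙ n → Fibre.Carrier n
  ⟦ rel (_ , α , _) ts ⟧ = reindex ts α
  ⟦_⟧ {n} ⊤ᶠ             = Fibre.⊤ n
  ⟦_⟧ {n} ⊥ᶠ             = Fibre.⊥ n
  ⟦_⟧ {n} (φ ∧ᶠ ψ)       = Fibre._∧_ n ⟦ φ ⟧ ⟦ ψ ⟧
  ⟦_⟧ {n} (φ ∨ᶠ ψ)       = Fibre._∨_ n ⟦ φ ⟧ ⟦ ψ ⟧
  ⟦_⟧ {n} (φ ⇒ᶠ ψ)       = Fibre._⇨_ n ⟦ φ ⟧ ⟦ ψ ⟧
  ⟦_⟧ {n} (¬ᶠ φ)         = Fibre.¬_ n ⟦ φ ⟧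
  ⟦_⟧ {n} (∀ᶠ φ)         = all n 1 ⟦ φ ⟧
  ⟦_⟧ {n} (∃ᶠ φ)         = some n 1 ⟦ φ ⟧

  ⟦/⟧ : ∀ {k n} (φ : Formula 𝔽 ℙ k) (ρ : Hom n k) →
        Fibre._≈_ n ⟦ φ / ρ ⟧ (reindex ρ ⟦ φ ⟧)
  ⟦/⟧ (rel (_ , α , _) ts) ρ = reindex-∘ ts ρ α
  ⟦/⟧ {n = n} ⊤ᶠ       ρ = Fibre.Eq.sym n (reindex-⊤ ρ)
  ⟦/⟧ {n = n} ⊥ᶠ       ρ = Fibre.Eq.sym n (reindex-⊥ ρ)
  ⟦/⟧ {n = n} (φ ∧ᶠ ψ) ρ = Fibre.Eq.trans n (FP.∧-cong n (⟦/⟧ φ ρ) (⟦/⟧ ψ ρ))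
    (Fibre.Eq.sym n (reindex-∧ ρ _ _))
  ⟦/⟧ {n = n} (φ ∨ᶠ ψ) ρ = Fibre.Eq.trans n (FP.∨-cong n (⟦/⟧ φ ρ) (⟦/⟧ ψ ρ))
    (Fibre.Eq.sym n (reindex-∨ ρ _ _))
  ⟦/⟧ {n = n} (φ ⇒ᶠ ψ) ρ = Fibre.Eq.trans n
    (FP.∨-cong n (Fibre.Eq.trans n (FP.¬-cong n (⟦/⟧ φ ρ)) (Fibre.Eq.sym n (reindex-¬ ρ _)))
                 (⟦/⟧ ψ ρ))
    (Fibre.Eq.sym n (reindex-∨ ρ _ _))
  ⟦/⟧ {n = n} (¬ᶠ φ)   ρ = Fibre.Eq.trans n (FP.¬-cong n (⟦/⟧ φ ρ))
    (Fibre.Eq.sym n (reindex-¬ ρ _))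
  -- Beck-Chevalley reindexes along `ρ ×id 1`, which is `ρ ↑` only up to the propositional equality
  -- `init⋆-++-wk⋆`.
  ⟦/⟧ {n = n} (∀ᶠ φ)   ρ = Fibre.Eq.trans n
    (all-cong n 1 (Fibre.Eq.trans (suc n) (⟦/⟧ φ (ρ ↑))
      (reindex-cong (≡.sym (init⋆-++-wk⋆ 1 ρ)) _)))
    (Fibre.Eq.sym n (beck-chevalley ρ 1 ⟦ φ ⟧))
  ⟦/⟧ {n = n} (∃ᶠ φ)   ρ = Fibre.Eq.trans n
    (FP.¬-cong n (all-cong n 1 (FP.¬-cong (suc n) (Fibre.Eq.trans (suc n) (⟦/⟧ φ (ρ ↑))
      (reindex-cong (≡.sym (init⋆-++-wk⋆ 1 ρ)) _)))))
    (Fibre.Eq.sym n (some-reindex ρ 1 ⟦ φ ⟧))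

  ⟦∀⋆⟧ : ∀ k {n} (φ : Formula 𝔽 ℙ (k + n)) → Fibre._≈_ n ⟦ ∀ᶠ⋆ k φ ⟧ (all n k ⟦ φ ⟧)
  ⟦∀⋆⟧ zero    {n} φ = Fibre.Eq.sym n (all-zero n ⟦ φ ⟧)
  ⟦∀⋆⟧ (suc k) {n} φ = Fibre.Eq.trans n (⟦∀⋆⟧ k (∀ᶠ φ)) (Fibre.Eq.sym n (all-suc n k ⟦ φ ⟧))

  -- The theory and soundness of the interpretation.

  𝒯 : Theory 𝔽 ℙ ℓ₁
  𝒯 φ = Fibre._≈_ 0 ⟦ φ ⟧ (Fibre.⊤ 0)

  open Provability 𝔽 ℙ 𝒯

  infix 4 _≤⋀_ _⋁≤_

  _≤⋀_ : ∀ {n} → Fibre.Carrier n → List (Formula 𝔽 ℙ n) → Set _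
  x ≤⋀ Γ = All (λ φ → Fibre._≤_ _ x ⟦ φ ⟧) Γ

  _⋁≤_ : ∀ {n} → List (Formula 𝔽 ℙ n) → Fibre.Carrier n → Set _
  Δ ⋁≤ y = All (λ φ → Fibre._≤_ _ ⟦ φ ⟧ y) Δ

  module _ {n : ℕ} where
    open Fibre n using (_≈_; _≤_; reflexive; module Eq) renaming (trans to ≤-trans)
    private
      module S = Fibre (suc n)

    ≤⋀-anti : ∀ {x x′ Γ} → x′ ≤ x → x ≤⋀ Γ → x′ ≤⋀ Γ
    ≤⋀-anti h = All.map (≤-trans h)

    ⋁≤-mono : ∀ {y y′ Δ} → y ≤ y′ → Δ ⋁≤ y → Δ ⋁≤ y′
    ⋁≤-mono h = All.map (λ h′ → ≤-trans h′ h)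

    ≤⋀-wk : ∀ {x Γ} → x ≤⋀ Γ → reindex wk x ≤⋀ (Γ /ˡ wk)
    ≤⋀-wk xs = All.map⁺ (All.map (λ {φ} h →
      S.trans (reindex-mono wk h) (S.reflexive (S.Eq.sym (⟦/⟧ φ wk)))) xs)

    ⋁≤-wk : ∀ {y Δ} → Δ ⋁≤ y → (Δ /ˡ wk) ⋁≤ reindex wk y
    ⋁≤-wk ys = All.map⁺ (All.map (λ {φ} h →
      S.trans (S.reflexive (⟦/⟧ φ wk)) (reindex-mono wk h)) ys)

    some≤⋀ : ∀ {x Γ} → x ≤⋀ (Γ /ˡ wk) → some n 1 x ≤⋀ Γ
    some≤⋀ xs = All.map (λ {φ} h →
      some-least n 1 (S.trans h (S.reflexive (⟦/⟧ φ wk)))) (All.map⁻ xs)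

    ⋁≤all : ∀ {y Δ} → (Δ /ˡ wk) ⋁≤ y → Δ ⋁≤ all n 1 y
    ⋁≤all ys = All.map (λ {φ} h →
      all-intro n 1 (S.trans (S.reflexive (S.Eq.sym (⟦/⟧ φ wk))) h)) (All.map⁻ ys)

    -- The morphism `sub s` is a section of the projection `wk`. Pulling the counit of `all` and the
    -- unit of `some` back along it gives the instances of the quantifiers.
    reindex-sub-wk : ∀ (s : Term 𝔽 n) α → reindex (sub s) (reindex wk α) ≈ α
    reindex-sub-wk s α = Eq.trans (Eq.sym (reindex-∘ wk (sub s) α))
      (Eq.trans (reindex-cong (≡.trans (map-weaken-⊙-∷ id s id) id-⊙) α) (reindex-id α))

    ∀-instance : ∀ ζ (s : Term 𝔽 n) → ⟦ ∀ᶠ ζ ⟧ ≤ ⟦ ζ / sub s ⟧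
    ∀-instance ζ s = ≤-trans (reflexive (Eq.sym (reindex-sub-wk s ⟦ ∀ᶠ ζ ⟧)))
      (≤-trans (reindex-mono (sub s) (all-counit n 1)) (reflexive (Eq.sym (⟦/⟧ ζ (sub s)))))

    ∃-instance : ∀ ζ (s : Term 𝔽 n) → ⟦ ζ / sub s ⟧ ≤ ⟦ ∃ᶠ ζ ⟧
    ∃-instance ζ s = ≤-trans (reflexive (⟦/⟧ ζ (sub s)))
      (≤-trans (reindex-mono (sub s) (some-unit n 1)) (reflexive (reindex-sub-wk s ⟦ ∃ᶠ ζ ⟧)))

  -- Quantifying over all bounds x and y, rather than taking the meet of Γ and the
  -- join of Δ, makes the structural rules immediate.
  mutual
    sound : ∀ {n Γ Δ} → Γ ⊢ Δ → ∀ {x y} → x ≤⋀ Γ → Δ ⋁≤ y → Fibre._≤_ n x y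
    sound {n} (axiom φ≈⊤) [] (φ≤y ∷ []) = trans (maximum _) (trans (reflexive (Eq.sym φ≈⊤)) φ≤y)
      where open Fibre n
    sound {n} identity (x≤φ ∷ []) (φ≤y ∷ []) = Fibre.trans n x≤φ φ≤y
    sound {n} (cut φ d d′) xs ys = FP.≤-cut n ⟦ φ ⟧ (soundR d xs ys) (soundL d′ xs ys)
    sound (weakenL d) (_ ∷ xs) ys = sound d xs ys
    sound (weakenR d) xs (_ ∷ ys) = sound d xs ys
    sound (contrL d) (h ∷ xs) ys = sound d (h ∷ h ∷ xs) ys
    sound (contrR d) xs (h ∷ ys) = sound d xs (h ∷ h ∷ ys)
    sound (exchL p d) xs ys = sound d (All-resp-↭ (↭-sym p) xs) ys
    sound (exchR p d) xs ys = sound d xs (All-resp-↭ (↭-sym p) ys)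
    sound {n} ⊤R xs (h ∷ ys) = Fibre.trans n (Fibre.maximum n _) h
    sound {n} ⊥L (h ∷ xs) ys = Fibre.trans n h (Fibre.minimum n _)
    sound {n} (∧L d) (h ∷ xs) ys =
      sound d (trans h (x∧y≤x _ _) ∷ trans h (x∧y≤y _ _) ∷ xs) ys
      where open Fibre n
    sound {n} (∧R {φ = φ} {ψ} d d′) xs (h ∷ ys) = FP.≤-cut n ⟦ φ ⟧ (soundR d xs ys)
      (FP.≤-cut n ⟦ ψ ⟧ (trans (x∧y≤x _ _) (soundR d′ xs ys))
        (trans (∧-greatest (trans (x∧y≤x _ _) (x∧y≤y _ _)) (x∧y≤y _ _)) h))
      where open Fibre n
    sound {n} (∨L {φ = φ} {ψ} d d′) (h ∷ xs) ys =
      FP.≤-cut n ⟦ φ ⟧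
        (FP.≤-cut n ⟦ ψ ⟧ (trans h (∨-least (trans (x≤x∨y _ _) (y≤x∨y _ _)) (x≤x∨y _ _)))
          (trans (soundL d′ xs ys) (y≤x∨y _ _)))
        (soundL d xs ys)
      where open Fibre n
    sound {n} (∨R d) xs (h ∷ ys) =
      sound d xs (trans (x≤x∨y _ _) h ∷ trans (y≤x∨y _ _) h ∷ ys)
      where open Fibre n
    sound {n} (¬L {φ = φ} d) (h ∷ xs) ys = FP.≤-cut n ⟦ φ ⟧ (soundR d xs ys)
      (trans (∧-greatest (trans (x∧y≤x _ _) h) (x∧y≤y _ _))
        (trans (FP.¬x∧x≤⊥ n) (minimum _)))
      where open Fibre n
    sound {n} (¬R d) xs (h ∷ ys) =
      trans (transpose-⇨ (soundL d xs ys)) (∨-least h (reflexive Eq.refl))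
      where open Fibre n
    sound {n} (⇒L {φ = φ} {ψ} d d′) (h ∷ xs) ys = FP.≤-cut n ⟦ φ ⟧ (soundR d xs ys)
      (FP.≤-cut n ⟦ ψ ⟧ (trans (transpose-∧ h) (x≤x∨y _ _))
        (trans (∧-greatest (trans (x∧y≤x _ _) (x∧y≤x _ _)) (x∧y≤y _ _)) (soundL d′ xs ys)))
      where open Fibre n
    sound {n} (⇒R d) xs (h ∷ ys) =
      -- Transposing yields `x ≤ ¬ φ ∨ (ψ ∨ y)`; both `¬ φ` and `ψ` lie below `φ ⇨ ψ`, which `h`
      -- bounds by `y`.
      trans (transpose-⇨ x∧φ≤ψ∨y) (∨-least (trans (x≤x∨y _ _) h)
        (∨-least (trans (y≤x∨y _ _) h) (reflexive Eq.refl)))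
      where
      open Fibre n
      x∧φ≤ψ∨y = soundR d (x∧y≤y _ _ ∷ ≤⋀-anti (x∧y≤x _ _) xs) ys
    -- x and y need not come from the smaller context: they are replaced by ∃x and ∀y.
    sound {n} (enlarge {n = k} d) xs ys = trans (some-unit k 1)
      (trans (reindex-mono wk (sound d (some≤⋀ xs) (⋁≤all ys))) (all-counit k 1))
      where open Fibre n
    sound {n} (∀L {ζ = ζ} s d) (h ∷ xs) ys = sound d (Fibre.trans n h (∀-instance ζ s) ∷ xs) ys
    sound {n} (∃R {ζ = ζ} s d) xs (h ∷ ys) = sound d xs (Fibre.trans n (∃-instance ζ s) h ∷ ys)
    sound {n} (∀R {ζ = ζ} d) {x} {y} xs (h ∷ ys) =
      -- The adjunction leaves no room for a disjunct beside `ζ`, so `y` moves to the left as `¬ y`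
      -- before quantifying and returns afterwards.
      trans (FP.x∧¬z≤y⇒x≤z∨y n (all-intro n 1 x∧¬y≤ζ)) (∨-least (reflexive Eq.refl) h)
      where
      open Fibre n
      module S = Fibre (suc n)
      x∧¬y≤ζ : reindex wk (x ∧ ¬ y) S.≤ ⟦ ζ ⟧
      x∧¬y≤ζ = S.trans (S.reflexive (S.Eq.trans (reindex-∧ wk x (¬ y))
          (FP.∧-cong (suc n) S.Eq.refl (reindex-¬ wk y))))
        (FP.x≤z∨y⇒x∧¬z≤y (suc n) (S.trans (soundR d (≤⋀-wk xs) (⋁≤-wk ys))
          (S.∨-least (S.y≤x∨y _ _) (S.x≤x∨y _ _))))
    sound {n} (∃L {ζ = ζ} d) {x} {y} (h ∷ xs) ys = trans
      -- Dually, the side condition `x` moves to the right as `x ⇨ y`; modus ponens then recovers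
      -- `y`.
      (∧-greatest (trans h (some-least n 1 ζ≤x⇨y)) (reflexive Eq.refl))
      (transpose-∧ (reflexive Eq.refl))
      where
      open Fibre n
      module S = Fibre (suc n)
      ζ≤x⇨y : ⟦ ζ ⟧ S.≤ reindex wk (x ⇨ y)
      ζ≤x⇨y = S.trans
        (S.transpose-⇨ (S.trans (S.∧-greatest (S.x∧y≤y _ _) (S.x∧y≤x _ _))
          (soundL d (≤⋀-wk xs) (⋁≤-wk ys))))
        (S.reflexive (S.Eq.sym (S.Eq.trans (reindex-∨ wk (¬ x) y)
          (FP.∨-cong (suc n) (reindex-¬ wk x) S.Eq.refl))))

    -- Soundness at the weaker bound `⟦ φ ⟧ ∨ y` frees the active formula from having to lie below
    -- `y`; `soundL` is the dual, with a meet.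
    soundR : ∀ {n Γ Δ φ} → Γ ⊢ φ ∷ Δ → ∀ {x y} → x ≤⋀ Γ → Δ ⋁≤ y →
             Fibre._≤_ n x (Fibre._∨_ n ⟦ φ ⟧ y)
    soundR {n} d xs ys = sound d xs (Fibre.x≤x∨y n _ _ ∷ ⋁≤-mono (Fibre.y≤x∨y n _ _) ys)

    soundL : ∀ {n Γ Δ φ} → φ ∷ Γ ⊢ Δ → ∀ {x y} → x ≤⋀ Γ → Δ ⋁≤ y →
             Fibre._≤_ n (Fibre._∧_ n x ⟦ φ ⟧) y
    soundL {n} d xs ys = sound d (Fibre.x∧y≤y n _ _ ∷ ≤⋀-anti (Fibre.x∧y≤x n _ _) xs) ys

  -- Universal closures and completeness.

  -- This is `∀ᶠ⋆ n` into the empty context, defined afresh because `n + 0` does not reduce to `n`.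
  closure : ∀ n → Formula 𝔽 ℙ n → Formula 𝔽 ℙ 0
  closure zero    φ = φ
  closure (suc n) φ = closure n (∀ᶠ φ)

  closure∈𝒯 : ∀ n {φ} → Fibre._≤_ n (Fibre.⊤ n) ⟦ φ ⟧ → closure n φ ∈ 𝒯
  closure∈𝒯 zero    ⊤≤φ = Fibre.antisym 0 (Fibre.maximum 0 _) ⊤≤φ
  closure∈𝒯 (suc n) ⊤≤φ = closure∈𝒯 n
    (all-intro n 1 (Fibre.trans (suc n) (Fibre.maximum (suc n) _) ⊤≤φ))

  -- Each quantifier is instantiated at the new variable of an enlarged context, so no closed term
  -- is required.
  closure-elim : ∀ n {φ} → [] ⊢ [ closure n φ ] → [] ⊢ [ φ ]
  closure-elim zero    d = d
  -- As `∀ᶠ-elim` needs a formula on the left, `⊤ᶠ` is put there and cut away again.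
  closure-elim (suc n) d = cut ⊤ᶠ ⊤R (∀ᶠ-elim (weakenL (closure-elim n d)))

  complete : ∀ {n} {φ ψ : Formula 𝔽 ℙ n} → Fibre._≤_ n ⟦ φ ⟧ ⟦ ψ ⟧ → φ ≤ᶠ ψ
  complete {n} {φ} {ψ} φ≤ψ = cut (φ ⇒ᶠ ψ)
    (exchR (↭-swap _ _ ↭-refl) (weakenR (weakenL ⊢φ⇒ψ)))
    (⇒L identityʳ identityˡ)
    where
    open Fibre n
    ⊢φ⇒ψ : [] ⊢ [ φ ⇒ᶠ ψ ]
    ⊢φ⇒ψ = closure-elim n (axiom (closure∈𝒯 n (transpose-⇨ (trans (x∧y≤y _ _) φ≤ψ))))

  complete-≈ : ∀ {n} {φ ψ : Formula 𝔽 ℙ n} → Fibre._≈_ n ⟦ φ ⟧ ⟦ ψ ⟧ → φ ≈ᶠ ψ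
  complete-≈ {n} h = complete (Fibre.reflexive n h) , complete (Fibre.reflexive n (Fibre.Eq.sym n h))

  sound-≈ : ∀ {n} {φ ψ : Formula 𝔽 ℙ n} → φ ≈ᶠ ψ → Fibre._≈_ n ⟦ φ ⟧ ⟦ ψ ⟧
  sound-≈ {n} (d , d′) = antisym
    (sound d (reflexive Eq.refl ∷ []) (reflexive Eq.refl ∷ []))
    (sound d′ (reflexive Eq.refl ∷ []) (reflexive Eq.refl ∷ []))
    where open Fibre n

  -- Definability of every element.

  Definable : ∀ X → Pred (Fibre.Carrier X) _
  Definable X α = Σ[ φ ∈ Formula 𝔽 ℙ X ] Fibre._≈_ X ⟦ φ ⟧ α

  definable-subalgebra : ∀ X → IsSubalgebra (fibre X) (Definable X)
  definable-subalgebra X = record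
    { respects-≈ = λ x≈y (φ , h) → φ , Eq.trans h x≈y
    ; ⊤-closed   = ⊤ᶠ , Eq.refl
    ; ⊥-closed   = ⊥ᶠ , Eq.refl
    ; ∧-closed   = λ (φ , h) (ψ , k) → φ ∧ᶠ ψ , FP.∧-cong X h k
    ; ∨-closed   = λ (φ , h) (ψ , k) → φ ∨ᶠ ψ , FP.∨-cong X h k
    ; ¬-closed   = λ (φ , h) → ¬ᶠ φ , FP.¬-cong X h
    }
    where open Fibre X

  P₀⇒definable : ∀ {X α} → α ∈ P₀ X → α ∈ Definable X
  P₀⇒definable {X} {α} α∈P₀ = rel (X , α , α∈P₀) id , reindex-id α

  stage⇒definable : ∀ n {X α} → α ∈ Stage P P₀ n X → α ∈ Definable X
  stage⇒definable zero    (lift α∈P₀) = P₀⇒definable α∈P₀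
  stage⇒definable (suc n) {X}         = Generated-least (definable-subalgebra X)
    λ (Y , β , β∈Pₙ , ∀β≈α) →
      let φ , φ≈β = stage⇒definable n β∈Pₙ in
      ∀ᶠ⋆ Y φ , Fibre.Eq.trans X (⟦∀⋆⟧ Y φ) (Fibre.Eq.trans X (all-cong X Y φ≈β) ∀β≈α)

  -- The stage supplied by `exhaustive` is data, so a formula is computed without choice. It
  -- respects `≈` only up to provable equivalence.
  define : ∀ {X} → Fibre.Carrier X → Formula 𝔽 ℙ X
  define {X} α = let n , α∈Pₙ = exhaustive X α in proj₁ (stage⇒definable n α∈Pₙ)

  ⟦define⟧ : ∀ {X} α → Fibre._≈_ X ⟦ define α ⟧ α
  ⟦define⟧ {X} α = let n , α∈Pₙ = exhaustive X α in proj₂ (stage⇒definable n α∈Pₙ)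

  -- Interpretation reflects equality, so `define α` is determined by its value. Each law of `toLT`
  -- thereby reduces to the matching law of `⟦_⟧`.
  define-unique : ∀ {X α φ} → Fibre._≈_ X α ⟦ φ ⟧ → define α ≈ᶠ φ
  define-unique {X} {α} h = complete-≈ (Fibre.Eq.trans X (⟦define⟧ α) h)

  -- The isomorphism of doctrines.

  idFunctor : FiniteProductFunctor (Ctx 𝔽) (Ctx 𝔽)
  idFunctor = record
    { F₀          = λ X → X
    ; F₁          = λ g → g
    ; F-cong      = λ g≡h → g≡h
    ; F-id        = refl
    ; F-∘         = λ _ _ → refl
    ; 𝟙-preserved = record { inverse = id ; inverseˡ = refl ; inverseʳ = refl }
    ; ×-preserved = λ X Y →
        let ⟨pr₁,pr₂⟩≡id = ++-unique id (⊙-id {ρ = pr₁ {X} {Y}}) (⊙-id {ρ = pr₂ {X} {Y}})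
        in record
          { inverse  = id
          ; inverseˡ = ≡.trans id-⊙ ⟨pr₁,pr₂⟩≡id
          ; inverseʳ = ≡.trans ⊙-id ⟨pr₁,pr₂⟩≡id
          }
    }

  toLT : FODoctrineMorphism P (LT 𝔽 ℙ 𝒯)
  toLT = record
    { functor        = idFunctor
    ; component      = λ X → define
    ; component-homo = λ X → let open Fibre X using (module Eq) in record
      { cong-≈ = λ x≈y → define-unique (Eq.trans x≈y (Eq.sym (⟦define⟧ _)))
      ; ⊤-homo = define-unique Eq.refl
      ; ⊥-homo = define-unique Eq.refl
      ; ∧-homo = λ x y → define-unique (Eq.sym (FP.∧-cong X (⟦define⟧ x) (⟦define⟧ y)))
      ; ∨-homo = λ x y → define-unique (Eq.sym (FP.∨-cong X (⟦define⟧ x) (⟦define⟧ y)))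
      ; ¬-homo = λ x → define-unique (Eq.sym (FP.¬-cong X (⟦define⟧ x)))
      }
    ; natural        = λ {X} g α → define-unique (Fibre.Eq.sym X
        (Fibre.Eq.trans X (⟦/⟧ (define α) g) (reindex-cong-≈ g (⟦define⟧ α))))
    ; all-preserved  = λ X Y α → define-unique (Fibre.Eq.sym X
        -- The substitution `id` is the inverse of the comparison map between products.
        (Fibre.Eq.trans X (⟦∀⋆⟧ Y (define α / id))
          (all-cong X Y (Fibre.Eq.trans (Y + X) (⟦/⟧ (define α) id)
            (Fibre.Eq.trans (Y + X) (reindex-id _) (⟦define⟧ α))))))
    }

  fromLT : FODoctrineMorphism (LT 𝔽 ℙ 𝒯) P
  fromLT = record
    { functor        = idFunctor
    ; component      = λ X → ⟦_⟧
    ; component-homo = λ X → let open Fibre X using (module Eq) in record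
      { cong-≈ = sound-≈
      ; ⊤-homo = Eq.refl
      ; ⊥-homo = Eq.refl
      ; ∧-homo = λ _ _ → Eq.refl
      ; ∨-homo = λ _ _ → Eq.refl
      ; ¬-homo = λ _ → Eq.refl
      }
    ; natural        = λ g φ → ⟦/⟧ φ g
    ; all-preserved  = λ X Y φ → Fibre.Eq.trans X (⟦∀⋆⟧ Y φ)
        (all-cong X Y (Fibre.Eq.sym (Y + X) (reindex-id ⟦ φ ⟧)))
    }

  isomorphism : FODoctrineIsomorphism P (LT 𝔽 ℙ 𝒯)
  isomorphism = record
    { to      = toLT
    ; from    = fromLT
    ; from∘to = record
      { on-objects   = λ _ → refl
      ; on-morphisms = λ _ → refl
      ; on-fibres    = λ _ → ⟦define⟧
      }
    ; to∘from = record
      { on-objects   = λ _ → refl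
      ; on-morphisms = λ _ → refl
      ; on-fibres    = λ X _ → define-unique (Fibre.Eq.refl X)
      }
    }

  -- Correspondence of the quantifier-free fragments.

  quantifierFree⇒P₀ : ∀ {X} {φ : Formula 𝔽 ℙ X} → QuantifierFree 𝔽 ℙ φ → ⟦ φ ⟧ ∈ P₀ X
  quantifierFree⇒P₀ (rel (_ , _ , α∈P₀) ts) = reindex-closed ts α∈P₀
  quantifierFree⇒P₀ {X} ⊤ᶠ       = IsSubalgebra.⊤-closed (isSubalgebra X)
  quantifierFree⇒P₀ {X} ⊥ᶠ       = IsSubalgebra.⊥-closed (isSubalgebra X)
  quantifierFree⇒P₀ {X} (φ ∧ᶠ ψ) =
    IsSubalgebra.∧-closed (isSubalgebra X) (quantifierFree⇒P₀ φ) (quantifierFree⇒P₀ ψ)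
  quantifierFree⇒P₀ {X} (φ ∨ᶠ ψ) =
    IsSubalgebra.∨-closed (isSubalgebra X) (quantifierFree⇒P₀ φ) (quantifierFree⇒P₀ ψ)
  quantifierFree⇒P₀ {X} (φ ⇒ᶠ ψ) = IsSubalgebra.∨-closed (isSubalgebra X)
    (IsSubalgebra.¬-closed (isSubalgebra X) (quantifierFree⇒P₀ φ)) (quantifierFree⇒P₀ ψ)
  quantifierFree⇒P₀ {X} (¬ᶠ φ)   =
    IsSubalgebra.¬-closed (isSubalgebra X) (quantifierFree⇒P₀ φ)

  P₀⇔LT₀ : ∀ X α → (α ∈ P₀ X) ⇔ (define α ∈ LT₀ 𝔽 ℙ 𝒯 X)
  P₀⇔LT₀ X α = mk⇔
    (λ α∈P₀ → let φ , φ≈α = P₀⇒definable α∈P₀ in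
      -- The formula from `P₀⇒definable` computes to an atom on the variables of the context, hence
      -- is quantifier-free; the one chosen by `define` need not be.
      φ , rel _ _ , define-unique (Fibre.Eq.sym X φ≈α))
    (λ (φ , qf , α≈φ) → IsSubalgebra.respects-≈ (isSubalgebra X)
      (Fibre.Eq.trans X (Fibre.Eq.sym X (sound-≈ α≈φ)) (⟦define⟧ α))
      (quantifierFree⇒P₀ qf))

theorem3p9 : ∀ {f c ℓ₁ ℓ₂ p : Level} (𝔽 : Signature f)
    (P : FirstOrderBooleanDoctrine (Ctx 𝔽) c ℓ₁ ℓ₂) (F : QuantifierFreeFragment P p) →
    let module P = FirstOrderBooleanDoctrine P
        open QuantifierFreeFragment F using (P₀)
    in
    Σ[ ℙ ∈ Signature (c ⊔ p) ] Σ[ 𝒯 ∈ Theory 𝔽 ℙ ℓ₁ ]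
    Σ[ I ∈ FODoctrineIsomorphism P (LT 𝔽 ℙ 𝒯) ]
      (let open FODoctrineMorphism (FODoctrineIsomorphism.to I) in
       ∀ X (α : P.Fibre.Carrier X) → (α ∈ P₀ X) ⇔ (component X α ∈ LT₀ 𝔽 ℙ 𝒯 (F₀ X)))
theorem3p9 𝔽 P F = ℙ , 𝒯 , isomorphism , P₀⇔LT₀
  where open FragmentLanguage 𝔽 P F
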